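{- There is a function $\varepsilon$ of the positive integer $q$ with $\varepsilon(q)\to 0$ as $q\to\infty$ such that, for every finite projective plane $\Pi_q$ (not necessarily Desarguesian) of order $q\ge 2$, the minimum size of a saturating set $S$ in $\Pi_q$ satisfies $$\min |S| \le (\sqrt{3}+\varepsilon(q))\sqrt{q\ln q}.$$
   Context: A projective plane of order $q$ has $q^2+q+1$ points and $q^2+q+1$ lines, with $q+1$ points on every line and $q+1$ lines through every point. A set $S$ of points of $\Pi_q$ is called saturating if every point of $\Pi_q$ outside $S$ is collinear with two distinct points of $S$ (i.e. lies on a line containing two distinct points of $S$). -}

module Defs where

open import Data.Fin.Base using (Fin)
open import Data.Fin.Subset using (Subset; ∣_∣; _∈_; _∉_)
open import Data.Integer.Base using (+_; -[1+_])
import Data.Integer.Base as ℤ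
import Data.Integer.Properties as ℤ
open import Data.Nat.Base as ℕ using (ℕ; zero; suc)
import Data.Nat.Properties as ℕ
open import Data.Nat.Tactic.RingSolver using (solve-∀)
open import Data.Product using (∃-syntax; ∃!; _×_; _,_; proj₁; proj₂)
open import Data.Rational.Base as ℚ
  using (ℚ; mkℚ; 0ℚ; 1ℚ; ½; _/_; toℚᵘ; Positive)
import Data.Rational.Properties as ℚ
open import Data.Rational.Solver using (module +-*-Solver)
open import Data.Rational.Unnormalised.Base as ℚᵘ using (mkℚᵘ)
import Data.Rational.Unnormalised.Properties as ℚᵘ
open import Data.Sum.Base using (inj₁; inj₂)
open import Data.Vec.Base using (tabulate)
open import Relation.Binary.Definitions using (Decidable)
open import Relation.Binary.PropositionalEquality
  using (_≡_; _≢_; refl; sym; trans; cong; cong₂; subst; subst₂)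
open import Relation.Nullary using (¬_; yes; no; does; contradiction)

record ProjectivePlane : Set₁ where
  field
    #points #lines : ℕ

  Point : Set
  Point = Fin #points

  Line : Set
  Line = Fin #lines

  field
    _I_  : Point → Line → Set
    _I?_ : Decidable _I_

  NonCollinear : Point → Point → Point → Set
  NonCollinear A B C = ∀ l → ¬ (A I l × B I l × C I l)

  field
    join : ∀ {A B} → A ≢ B → ∃! _≡_ λ l → A I l × B I l
    meet : ∀ {k l} → k ≢ l → ∃! _≡_ λ P → P I k × P I l
    quadrangle : ∃[ A ] ∃[ B ] ∃[ C ] ∃[ D ]
      NonCollinear A B C × NonCollinear A B D ×
      NonCollinear A C D × NonCollinear B C D

  pointsOn : Line → Subset #points
  pointsOn l = tabulate λ P → does (P I? l)

  linesThrough : Point → Subset #lines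
  linesThrough P = tabulate λ l → does (P I? l)

  Saturating : Subset #points → Set
  Saturating S = ∀ P → P ∉ S →
    ∃[ A ] ∃[ B ] ∃[ l ] A ∈ S × B ∈ S × A ≢ B × A I l × B I l × P I l

  IsMinSaturatingSize : ℕ → Set
  IsMinSaturatingSize m =
    (∃[ S ] Saturating S × ∣ S ∣ ≡ m) ×
    (∀ S → Saturating S → m ℕ.≤ ∣ S ∣)

record HasOrder (Π : ProjectivePlane) (q : ℕ) : Set where
  open ProjectivePlane Π
  field
    #points≡       : #points ≡ q ℕ.* q ℕ.+ q ℕ.+ 1
    #lines≡        : #lines  ≡ q ℕ.* q ℕ.+ q ℕ.+ 1
    ∣pointsOn∣     : ∀ l → ∣ pointsOn l ∣ ≡ q ℕ.+ 1
    ∣linesThrough∣ : ∀ P → ∣ linesThrough P ∣ ≡ q ℕ.+ 1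

-- Real numbers as Cauchy sequences of rationals; two sequences with the same
-- limit may be different elements, so _≡_ is not equality of reals.
IsCauchy : (ℕ → ℚ) → Set
IsCauchy x = ∀ e → 0ℚ ℚ.< e →
  ∃[ N ] ∀ m n → N ℕ.≤ m → N ℕ.≤ n → ℚ.∣ x m ℚ.- x n ∣ ℚ.≤ e

record ℝ : Set where
  constructor mkℝ
  field
    seq    : ℕ → ℚ
    cauchy : IsCauchy seq

open ℝ public

infix 4 _≤ℝ_ _<ℝ_

_≤ℝ_ : ℝ → ℝ → Set
x ≤ℝ y = ∀ e → 0ℚ ℚ.< e →
  ∃[ N ] ∀ n → N ℕ.≤ n → seq x n ℚ.≤ seq y n ℚ.+ e

_<ℝ_ : ℝ → ℝ → Set
x <ℝ y = ∃[ e ] 0ℚ ℚ.< e ×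
  ∃[ N ] ∀ n → N ℕ.≤ n → seq x n ℚ.+ e ℚ.≤ seq y n

-- ⌊√n⌋
isqrt : ℕ → ℕ
isqrt zero    = 0
isqrt (suc n) with suc (isqrt n) ℕ.* suc (isqrt n) ℕ.≤? suc n
... | yes _ = suc (isqrt n)
... | no  _ = isqrt n

-- With N = n + 1, √(p/d) = √(p d N²) / (d N), so replacing the numerator
-- by its integer part gives r with r ≤ √(p/d) < r + 1/(d N).
-- Negative rationals are sent to 0.
√approx : ℚ → ℕ → ℚ
√approx (mkℚ (+ p) d-1 _) n =
  + isqrt (p ℕ.* suc d-1 ℕ.* (suc n ℕ.* suc n)) / (suc d-1 ℕ.* suc n)
√approx (mkℚ -[1+ _ ] _ _) n = 0ℚ

Σ[_] : ℕ → (ℕ → ℚ) → ℚ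
Σ[ zero  ] f = 0ℚ
Σ[ suc k ] f = Σ[ k ] f ℚ.+ f k

-- With N = n + 1, the sum of 1/(N + i) over 0 ≤ i < (q - 1) N: the left
-- Riemann sum of ∫₁^q dt/t with mesh 1/N, whose nodes are t = (N + i)/N.
lnApprox : ℕ → ℕ → ℚ
lnApprox q n = Σ[ (q ℕ.∸ 1) ℕ.* suc n ] λ i → + 1 / suc (n ℕ.+ i)

module CauchyProofs where

  open +-*-Solver

  frac : ℕ → ℕ → ℚ
  frac a b = + a / suc b

  opaque
    toℚᵘ-frac : ∀ a b → toℚᵘ (frac a b) ℚᵘ.≃ mkℚᵘ (+ a) b
    toℚᵘ-frac a b = ℚ.toℚᵘ-fromℚᵘ (mkℚᵘ (+ a) b)

    frac-≤ : ∀ a b c d → a ℕ.* suc d ℕ.≤ c ℕ.* suc b → frac a b ℚ.≤ frac c d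
    frac-≤ a b c d h = ℚ.toℚᵘ-cancel-≤
      (ℚᵘ.≤-respˡ-≃ (ℚᵘ.≃-sym (toℚᵘ-frac a b))
      (ℚᵘ.≤-respʳ-≃ (ℚᵘ.≃-sym (toℚᵘ-frac c d))
      (ℚᵘ.*≤* (subst₂ ℤ._≤_ (ℤ.pos-* a (suc d)) (ℤ.pos-* c (suc b))
        (ℤ.+≤+ h)))))

    frac-< : ∀ a b c d → a ℕ.* suc d ℕ.< c ℕ.* suc b → frac a b ℚ.< frac c d
    frac-< a b c d h = ℚ.toℚᵘ-cancel-<
      (ℚᵘ.<-respˡ-≃ (ℚᵘ.≃-sym (toℚᵘ-frac a b))
      (ℚᵘ.<-respʳ-≃ (ℚᵘ.≃-sym (toℚᵘ-frac c d))
      (ℚᵘ.*<* (subst₂ ℤ._<_ (ℤ.pos-* a (suc d)) (ℤ.pos-* c (suc b))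
        (ℤ.+<+ h)))))

    frac-* : ∀ a b c d →
      frac a b ℚ.* frac c d ≡ frac (a ℕ.* c) (d ℕ.+ b ℕ.* suc d)
    frac-* a b c d = ℚ.toℚᵘ-injective
      (ℚᵘ.≃-trans (ℚ.toℚᵘ-homo-* (frac a b) (frac c d))
      (ℚᵘ.≃-trans (ℚᵘ.*-cong (toℚᵘ-frac a b) (toℚᵘ-frac c d))
      (ℚᵘ.≃-trans (ℚᵘ.*≡* (cong (ℤ._* + suc (d ℕ.+ b ℕ.* suc d))
                                (sym (ℤ.pos-* a c))))
      (ℚᵘ.≃-sym (toℚᵘ-frac (a ℕ.* c) (d ℕ.+ b ℕ.* suc d))))))

    frac-+ : ∀ a c b → frac a b ℚ.+ frac c b ≡ frac (a ℕ.+ c) b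
    frac-+ a c b = ℚ.toℚᵘ-injective
      (ℚᵘ.≃-trans (ℚ.toℚᵘ-homo-+ (frac a b) (frac c b))
      (ℚᵘ.≃-trans (ℚᵘ.+-cong (toℚᵘ-frac a b) (toℚᵘ-frac c b))
      (ℚᵘ.≃-trans (ℚᵘ.*≡* eq)
      (ℚᵘ.≃-sym (toℚᵘ-frac (a ℕ.+ c) b)))))
      where
      B : ℕ
      B = suc b
      natEq : ∀ a c B → (a ℕ.* B ℕ.+ c ℕ.* B) ℕ.* B ≡ (a ℕ.+ c) ℕ.* (B ℕ.* B)
      natEq = solve-∀
      eq : (+ a ℤ.* + B ℤ.+ + c ℤ.* + B) ℤ.* + B ≡ + (a ℕ.+ c) ℤ.* + (B ℕ.* B)
      eq = trans
        (cong (ℤ._* + B)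
          (trans (cong₂ ℤ._+_ (sym (ℤ.pos-* a B)) (sym (ℤ.pos-* c B)))
                 (sym (ℤ.pos-+ (a ℕ.* B) (c ℕ.* B)))))
        (trans (sym (ℤ.pos-* (a ℕ.* B ℕ.+ c ℕ.* B) B))
        (trans (cong +_ (natEq a c B))
               (ℤ.pos-* (a ℕ.+ c) (B ℕ.* B))))

    frac-nonNeg : ∀ a b → 0ℚ ℚ.≤ frac a b
    frac-nonNeg a b = frac-≤ 0 0 a b ℕ.z≤n

    frac-pos : ∀ a b → 0ℚ ℚ.< frac (suc a) b
    frac-pos a b = frac-< 0 0 (suc a) b (ℕ.s≤s ℕ.z≤n)

  opaque
    archimedean : ∀ {e} → 0ℚ ℚ.< e →
      ∃[ N ] ∀ n → N ℕ.≤ n → frac 1 n ℚ.≤ e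
    archimedean {mkℚ (+ zero) d c} (ℚ.*<* (ℤ.+<+ ()))
    archimedean {e@(mkℚ (+ suc a) d c)} _ = d , λ n d≤n →
      subst (frac 1 n ℚ.≤_) (ℚ.fromℚᵘ-toℚᵘ e)
        (frac-≤ 1 n (suc a) d
          (ℕ.≤-trans (ℕ.≤-reflexive (ℕ.*-identityˡ (suc d)))
          (ℕ.≤-trans (ℕ.s≤s d≤n) (ℕ.m≤m+n (suc n) (a ℕ.* suc n)))))
    archimedean {mkℚ (-[1+ _ ]) d c} (ℚ.*<* ())

  opaque
    p≤∣p∣ : ∀ p → p ℚ.≤ ℚ.∣ p ∣
    p≤∣p∣ p with ℚ.≤-total 0ℚ p
    ... | inj₁ 0≤p = ℚ.≤-reflexive (sym (ℚ.0≤p⇒∣p∣≡p 0≤p))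
    ... | inj₂ p≤0 = ℚ.≤-trans p≤0 (ℚ.0≤∣p∣ p)

    -‿swap : ∀ a b → b ℚ.- a ≡ ℚ.- (a ℚ.- b)
    -‿swap = solve 2 (λ a b → b :- a := :- (a :- b)) refl

    ∣-∣-swap : ∀ a b → ℚ.∣ a ℚ.- b ∣ ≡ ℚ.∣ b ℚ.- a ∣
    ∣-∣-swap a b = trans (sym (ℚ.∣-p∣≡∣p∣ (a ℚ.- b)))
                         (cong ℚ.∣_∣ (sym (-‿swap a b)))

    diff : ∀ a b → b ℚ.+ (a ℚ.- b) ≡ a
    diff = solve 2 (λ a b → b :+ (a :- b) := a) refl

    undiff : ∀ b e → (b ℚ.+ e) ℚ.- b ≡ e
    undiff = solve 2 (λ b e → (b :+ e) :- b := e) refl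

    dist-elim : ∀ a b {e} → ℚ.∣ a ℚ.- b ∣ ℚ.≤ e → a ℚ.≤ b ℚ.+ e
    dist-elim a b h = subst (ℚ._≤ _) (diff a b)
      (ℚ.+-monoʳ-≤ b (ℚ.≤-trans (p≤∣p∣ (a ℚ.- b)) h))

    dist-intro : ∀ a b {e} → a ℚ.≤ b ℚ.+ e → b ℚ.≤ a ℚ.+ e →
      ℚ.∣ a ℚ.- b ∣ ℚ.≤ e
    dist-intro a b {e} h k with ℚ.∣p∣≡p∨∣p∣≡-p (a ℚ.- b)
    ... | inj₁ eq = subst (ℚ._≤ e) (sym eq)
      (subst (a ℚ.- b ℚ.≤_) (undiff b e) (ℚ.+-monoˡ-≤ (ℚ.- b) h))
    ... | inj₂ eq = subst (ℚ._≤ e) (trans (-‿swap a b) (sym eq))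
      (subst (b ℚ.- a ℚ.≤_) (undiff a e) (ℚ.+-monoˡ-≤ (ℚ.- a) k))

    ½-pos : ∀ {e} → 0ℚ ℚ.< e → 0ℚ ℚ.< ½ ℚ.* e
    ½-pos {e} h = ℚ.positive⁻¹ (½ ℚ.* e)
      {{ℚ.pos*pos⇒pos ½ e {{ℚ.positive h}}}}

    halves : ∀ e → ½ ℚ.* e ℚ.+ ½ ℚ.* e ≡ e
    halves = solve 1 (λ e → con ½ :* e :+ con ½ :* e := e) refl

  opaque
    const-cauchy : ∀ c → IsCauchy (λ _ → c)
    const-cauchy c e 0<e = 0 , λ _ _ _ _ →
      subst (λ z → ℚ.∣ z ∣ ℚ.≤ e) (sym (ℚ.+-inverseʳ c)) (ℚ.<⇒≤ 0<e)

  opaque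
    neg-cauchy : ∀ x → IsCauchy x → IsCauchy (λ n → ℚ.- x n)
    neg-cauchy x cx e 0<e = let N , h = cx e 0<e in N , λ m n N≤m N≤n →
      subst (ℚ._≤ e) (cong ℚ.∣_∣ (eq (x m) (x n))) (h n m N≤n N≤m)
      where
      eq : ∀ a b → b ℚ.- a ≡ ℚ.- a ℚ.- ℚ.- b
      eq = solve 2 (λ a b → b :- a := :- a :- :- b) refl

  opaque
    abs-cauchy : ∀ x → IsCauchy x → IsCauchy (λ n → ℚ.∣ x n ∣)
    abs-cauchy x cx e 0<e = let N , h = cx e 0<e in N , λ m n N≤m N≤n →
      dist-intro _ _ (half (x m) (x n) (h m n N≤m N≤n))
                     (half (x n) (x m) (h n m N≤n N≤m))
      where
      half : ∀ a b → ℚ.∣ a ℚ.- b ∣ ℚ.≤ e → ℚ.∣ a ∣ ℚ.≤ ℚ.∣ b ∣ ℚ.+ e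
      half a b h = ℚ.≤-trans
        (subst (λ z → ℚ.∣ z ∣ ℚ.≤ ℚ.∣ b ∣ ℚ.+ ℚ.∣ a ℚ.- b ∣) (diff a b)
          (ℚ.∣p+q∣≤∣p∣+∣q∣ b (a ℚ.- b)))
        (ℚ.+-monoʳ-≤ ℚ.∣ b ∣ h)

  opaque
    +-cauchy : ∀ x y → IsCauchy x → IsCauchy y → IsCauchy (λ n → x n ℚ.+ y n)
    +-cauchy x y cx cy e 0<e =
      let N , h = cx (½ ℚ.* e) (½-pos 0<e)
          M , k = cy (½ ℚ.* e) (½-pos 0<e)
      in N ℕ.⊔ M , λ m n ≤m ≤n →
      subst₂ ℚ._≤_ (cong ℚ.∣_∣ (eq (x m) (y m) (x n) (y n))) (halves e)
        (ℚ.≤-trans (ℚ.∣p+q∣≤∣p∣+∣q∣ (x m ℚ.- x n) (y m ℚ.- y n))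
          (ℚ.+-mono-≤
            (h m n (ℕ.m⊔n≤o⇒m≤o N M ≤m) (ℕ.m⊔n≤o⇒m≤o N M ≤n))
            (k m n (ℕ.m⊔n≤o⇒n≤o N M ≤m) (ℕ.m⊔n≤o⇒n≤o N M ≤n))))
      where
      eq : ∀ a b c d → (a ℚ.- c) ℚ.+ (b ℚ.- d) ≡ (a ℚ.+ b) ℚ.- (c ℚ.+ d)
      eq = solve 4 (λ a b c d →
        (a :- c) :+ (b :- d) := (a :+ b) :- (c :+ d)) refl

  opaque
    0<1 : 0ℚ ℚ.< 1ℚ
    0<1 = frac-pos 0 0

  opaque
    bounded : ∀ x → IsCauchy x →
      ∃[ K ] 0ℚ ℚ.< K × ∃[ N ] ∀ n → N ℕ.≤ n → ℚ.∣ x n ∣ ℚ.≤ K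
    bounded x cx = let N , h = abs-cauchy x cx 1ℚ 0<1 in
        ℚ.∣ x N ∣ ℚ.+ 1ℚ
      , ℚ.<-≤-trans 0<1 (subst (ℚ._≤ ℚ.∣ x N ∣ ℚ.+ 1ℚ) (ℚ.+-identityˡ 1ℚ)
          (ℚ.+-monoˡ-≤ 1ℚ (ℚ.0≤∣p∣ (x N))))
      , N
      , λ n N≤n → dist-elim ℚ.∣ x n ∣ ℚ.∣ x N ∣ {1ℚ} (h n N N≤n ℕ.≤-refl)

  opaque
    mulBound : ∀ {a b c d} → 0ℚ ℚ.≤ b → 0ℚ ℚ.≤ c →
      a ℚ.≤ c → b ℚ.≤ d → a ℚ.* b ℚ.≤ c ℚ.* d
    mulBound {a} {b} {c} {d} 0≤b 0≤c a≤c b≤d = ℚ.≤-trans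
      (ℚ.*-monoʳ-≤-nonNeg b {{ℚ.nonNegative 0≤b}} a≤c)
      (ℚ.*-monoˡ-≤-nonNeg c {{ℚ.nonNegative 0≤c}} b≤d)

  opaque
    *-cauchy : ∀ x y → IsCauchy x → IsCauchy y → IsCauchy (λ n → x n ℚ.* y n)
    *-cauchy x y cx cy e 0<e = result
      where
      K L : ℚ
      K = proj₁ (bounded x cx)
      L = proj₁ (bounded y cy)
      0<K : 0ℚ ℚ.< K
      0<K = proj₁ (proj₂ (bounded x cx))
      0<L : 0ℚ ℚ.< L
      0<L = proj₁ (proj₂ (bounded y cy))
      N₁ N₂ : ℕ
      N₁ = proj₁ (proj₂ (proj₂ (bounded x cx)))
      N₂ = proj₁ (proj₂ (proj₂ (bounded y cy)))
      hK : ∀ n → N₁ ℕ.≤ n → ℚ.∣ x n ∣ ℚ.≤ K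
      hK = proj₂ (proj₂ (proj₂ (bounded x cx)))
      hL : ∀ n → N₂ ℕ.≤ n → ℚ.∣ y n ∣ ℚ.≤ L
      hL = proj₂ (proj₂ (proj₂ (bounded y cy)))
      instance
        posK : Positive K
        posK = ℚ.positive 0<K
        posL : Positive L
        posL = ℚ.positive 0<L
        posE : Positive e
        posE = ℚ.positive 0<e
        posKL : Positive (K ℚ.+ L)
        posKL = ℚ.pos+pos⇒pos K L
        nzKL : ℚ.NonZero (K ℚ.+ L)
        nzKL = ℚ.pos⇒nonZero (K ℚ.+ L)
        posInv : Positive (ℚ.1/ (K ℚ.+ L))
        posInv = ℚ.1/pos⇒pos (K ℚ.+ L)
      e₁ : ℚ
      e₁ = ℚ.1/ (K ℚ.+ L) ℚ.* e
      0<e₁ : 0ℚ ℚ.< e₁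
      0<e₁ = ℚ.positive⁻¹ e₁ {{ℚ.pos*pos⇒pos (ℚ.1/ (K ℚ.+ L)) e}}
      total : K ℚ.* e₁ ℚ.+ L ℚ.* e₁ ≡ e
      total = trans (sym (ℚ.*-distribʳ-+ e₁ K L))
        (trans (sym (ℚ.*-assoc (K ℚ.+ L) (ℚ.1/ (K ℚ.+ L)) e))
        (trans (cong (ℚ._* e) (ℚ.*-inverseʳ (K ℚ.+ L))) (ℚ.*-identityˡ e)))
      eq : ∀ a b c d → a ℚ.* (b ℚ.- d) ℚ.+ d ℚ.* (a ℚ.- c) ≡ a ℚ.* b ℚ.- c ℚ.* d
      eq = solve 4 (λ a b c d →
        a :* (b :- d) :+ d :* (a :- c) := a :* b :- c :* d) refl
      prodBound : ∀ a b {A B} → 0ℚ ℚ.≤ A → ℚ.∣ a ∣ ℚ.≤ A → ℚ.∣ b ∣ ℚ.≤ B →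
        ℚ.∣ a ℚ.* b ∣ ℚ.≤ A ℚ.* B
      prodBound a b 0≤A ha hb = subst (ℚ._≤ _) (sym (ℚ.∣p*q∣≡∣p∣*∣q∣ a b))
        (mulBound (ℚ.0≤∣p∣ b) 0≤A ha hb)
      result : ∃[ N ] ∀ m n → N ℕ.≤ m → N ℕ.≤ n →
        ℚ.∣ x m ℚ.* y m ℚ.- x n ℚ.* y n ∣ ℚ.≤ e
      result =
        let M₁ , h = cx e₁ 0<e₁
            M₂ , k = cy e₁ 0<e₁
        in (N₁ ℕ.⊔ N₂) ℕ.⊔ (M₁ ℕ.⊔ M₂) , λ m n ≤m ≤n →
        let ≤m₁ = ℕ.m⊔n≤o⇒m≤o (N₁ ℕ.⊔ N₂) (M₁ ℕ.⊔ M₂) ≤m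
            ≤m₂ = ℕ.m⊔n≤o⇒n≤o (N₁ ℕ.⊔ N₂) (M₁ ℕ.⊔ M₂) ≤m
            ≤n₁ = ℕ.m⊔n≤o⇒m≤o (N₁ ℕ.⊔ N₂) (M₁ ℕ.⊔ M₂) ≤n
            ≤n₂ = ℕ.m⊔n≤o⇒n≤o (N₁ ℕ.⊔ N₂) (M₁ ℕ.⊔ M₂) ≤n
        in
        subst₂ ℚ._≤_ (cong ℚ.∣_∣ (eq (x m) (y m) (x n) (y n))) total
          (ℚ.≤-trans
            (ℚ.∣p+q∣≤∣p∣+∣q∣ (x m ℚ.* (y m ℚ.- y n)) (y n ℚ.* (x m ℚ.- x n)))
            (ℚ.+-mono-≤
              (prodBound (x m) (y m ℚ.- y n) (ℚ.<⇒≤ 0<K)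
                (hK m (ℕ.m⊔n≤o⇒m≤o N₁ N₂ ≤m₁))
                (k m n (ℕ.m⊔n≤o⇒n≤o M₁ M₂ ≤m₂) (ℕ.m⊔n≤o⇒n≤o M₁ M₂ ≤n₂)))
              (prodBound (y n) (x m ℚ.- x n) (ℚ.<⇒≤ 0<L)
                (hL n (ℕ.m⊔n≤o⇒n≤o N₁ N₂ ≤n₁))
                (h m n (ℕ.m⊔n≤o⇒m≤o M₁ M₂ ≤m₂) (ℕ.m⊔n≤o⇒m≤o M₁ M₂ ≤n₂)))))

  opaque
    isqrt-lower : ∀ n → isqrt n ℕ.* isqrt n ℕ.≤ n
    isqrt-lower zero = ℕ.z≤n
    isqrt-lower (suc n) with suc (isqrt n) ℕ.* suc (isqrt n) ℕ.≤? suc n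
    ... | yes p = p
    ... | no  _ = ℕ.m≤n⇒m≤1+n (isqrt-lower n)

    isqrt-upper : ∀ n → n ℕ.< suc (isqrt n) ℕ.* suc (isqrt n)
    isqrt-upper zero = ℕ.s≤s ℕ.z≤n
    isqrt-upper (suc n) with suc (isqrt n) ℕ.* suc (isqrt n) ℕ.≤? suc n
    ... | yes _ = ℕ.≤-<-trans (isqrt-upper n)
      (ℕ.*-mono-< (ℕ.n<1+n (suc (isqrt n))) (ℕ.n<1+n (suc (isqrt n))))
    ... | no ¬p = ℕ.≰⇒> ¬p

  opaque
    √approx-nonNeg : ∀ a n → 0ℚ ℚ.≤ √approx a n
    √approx-nonNeg (mkℚ (+ p) d _) n = frac-nonNeg
      (isqrt (p ℕ.* suc d ℕ.* (suc n ℕ.* suc n))) (n ℕ.+ d ℕ.* suc n)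
    √approx-nonNeg (mkℚ -[1+ _ ] _ _) n = ℚ.≤-refl

    √approx-lower : ∀ a n → 0ℚ ℚ.< √approx a n →
      √approx a n ℚ.* √approx a n ℚ.≤ a
    √approx-lower a@(mkℚ (+ p) d _) n _ = subst₂ ℚ._≤_
      (sym (frac-* k dN k dN)) (ℚ.fromℚᵘ-toℚᵘ a)
      (frac-≤ (k ℕ.* k) (dN ℕ.+ dN ℕ.* suc dN) p d
        (ℕ.≤-trans (ℕ.*-monoˡ-≤ (suc d) (isqrt-lower pdNN))
          (ℕ.≤-reflexive (eq p (suc d) (suc n)))))
      where
      pdNN k dN : ℕ
      pdNN = p ℕ.* suc d ℕ.* (suc n ℕ.* suc n)
      k    = isqrt pdNN
      dN   = n ℕ.+ d ℕ.* suc n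
      eq : ∀ p d n →
        p ℕ.* d ℕ.* (n ℕ.* n) ℕ.* d ≡ p ℕ.* (d ℕ.* n ℕ.* (d ℕ.* n))
      eq = solve-∀
    √approx-lower (mkℚ -[1+ _ ] _ _) n 0<0 =
      contradiction 0<0 (ℚ.<-irrefl refl)

    √approx-upper : ∀ a n → a ℚ.<
      (√approx a n ℚ.+ frac 1 n) ℚ.* (√approx a n ℚ.+ frac 1 n)
    √approx-upper a@(mkℚ (+ p) d _) n = ℚ.<-≤-trans
      (subst₂ ℚ._<_ (ℚ.fromℚᵘ-toℚᵘ a) (sym (frac-* (suc k) dN (suc k) dN))
        (frac-< p d (suc k ℕ.* suc k) (dN ℕ.+ dN ℕ.* suc dN)
          (ℕ.≤-<-trans (ℕ.≤-reflexive (sym (eq p (suc d) (suc n))))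
            (ℕ.*-monoˡ-< (suc d) (isqrt-upper pdNN)))))
      (mulBound (frac-nonNeg (suc k) dN) (ℚ.≤-trans (frac-nonNeg (suc k) dN) le)
        le le)
      where
      pdNN k dN : ℕ
      pdNN = p ℕ.* suc d ℕ.* (suc n ℕ.* suc n)
      k    = isqrt pdNN
      dN   = n ℕ.+ d ℕ.* suc n
      eq : ∀ p d n →
        p ℕ.* d ℕ.* (n ℕ.* n) ℕ.* d ≡ p ℕ.* (d ℕ.* n ℕ.* (d ℕ.* n))
      eq = solve-∀
      le : frac (suc k) dN ℚ.≤ frac k dN ℚ.+ frac 1 n
      le = subst (ℚ._≤ frac k dN ℚ.+ frac 1 n)
        (trans (frac-+ k 1 dN) (cong (λ z → frac z dN) (ℕ.+-comm k 1)))
        (ℚ.+-monoʳ-≤ (frac k dN) (frac-≤ 1 dN 1 n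
          (ℕ.*-monoʳ-≤ 1 (ℕ.m≤m+n (suc n) (d ℕ.* suc n)))))
    √approx-upper (mkℚ -[1+ a ] d c) n = ℚ.<-trans (ℚ.*<* ℤ.-<+)
      (subst (λ z → 0ℚ ℚ.< z ℚ.* z) (sym (ℚ.+-identityˡ (frac 1 n)))
        (subst (0ℚ ℚ.<_) (sym (frac-* 1 n 1 n)) (frac-pos 0 (n ℕ.+ n ℕ.* suc n))))

  opaque
    √-cauchy : ∀ x → IsCauchy x → IsCauchy (λ n → √approx (x n) n)
    √-cauchy x cx e 0<e = result
      where
      δ : ℚ
      δ = ½ ℚ.* e
      0<δ : 0ℚ ℚ.< δ
      0<δ = ½-pos 0<e
      0<δ² : 0ℚ ℚ.< δ ℚ.* δ
      0<δ² = ℚ.positive⁻¹ (δ ℚ.* δ)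
        {{ℚ.pos*pos⇒pos δ {{ℚ.positive 0<δ}} δ {{ℚ.positive 0<δ}}}}
      r : ℕ → ℚ
      r n = √approx (x n) n
      sq : ∀ s d → s ℚ.* s ℚ.+ d ℚ.* d ℚ.+ (s ℚ.* d ℚ.+ d ℚ.* s)
                 ≡ (s ℚ.+ d) ℚ.* (s ℚ.+ d)
      sq = solve 2 (λ s d →
        s :* s :+ d :* d :+ (s :* d :+ d :* s) := (s :+ d) :* (s :+ d)) refl
      0≤ab : ∀ {a b} → 0ℚ ℚ.≤ a → 0ℚ ℚ.≤ b → 0ℚ ℚ.≤ a ℚ.* b
      0≤ab {a} {b} 0≤a 0≤b = ℚ.nonNegative⁻¹ (a ℚ.* b)
        {{ℚ.nonNeg*nonNeg⇒nonNeg a {{ℚ.nonNegative 0≤a}}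
                                 b {{ℚ.nonNegative 0≤b}}}}
      sq-≤ : ∀ {s d} → 0ℚ ℚ.≤ s → 0ℚ ℚ.≤ d →
        s ℚ.* s ℚ.+ d ℚ.* d ℚ.≤ (s ℚ.+ d) ℚ.* (s ℚ.+ d)
      sq-≤ {s} {d} 0≤s 0≤d = subst₂ ℚ._≤_ (ℚ.+-identityʳ _) (sq s d)
        (ℚ.+-monoʳ-≤ (s ℚ.* s ℚ.+ d ℚ.* d)
          (ℚ.+-mono-≤ (0≤ab 0≤s 0≤d) (0≤ab 0≤d 0≤s)))
      half : ∀ m n → x m ℚ.≤ x n ℚ.+ δ ℚ.* δ → frac 1 n ℚ.≤ δ →
        r m ℚ.≤ r n ℚ.+ e
      half m n close fine = ℚ.≮⇒≥ λ far →
        let s = r n ℚ.+ frac 1 n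
            0≤s : 0ℚ ℚ.≤ s
            0≤s = ℚ.+-mono-≤ (√approx-nonNeg (x n) n) (frac-nonNeg 1 n)
            0≤s+δ : 0ℚ ℚ.≤ s ℚ.+ δ
            0≤s+δ = ℚ.+-mono-≤ 0≤s (ℚ.<⇒≤ 0<δ)
            s+δ≤ : s ℚ.+ δ ℚ.≤ r n ℚ.+ e
            s+δ≤ = subst (s ℚ.+ δ ℚ.≤_)
              (trans (ℚ.+-assoc (r n) δ δ) (cong (r n ℚ.+_) (halves e)))
              (ℚ.+-monoˡ-≤ δ (ℚ.+-monoʳ-≤ (r n) fine))
            s+δ<r : s ℚ.+ δ ℚ.< r m
            s+δ<r = ℚ.≤-<-trans s+δ≤ far
        in ℚ.<-irrefl refl
          (ℚ.<-≤-trans (ℚ.+-monoˡ-< (δ ℚ.* δ) (√approx-upper (x n) n))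
          (ℚ.≤-trans (sq-≤ 0≤s (ℚ.<⇒≤ 0<δ))
          (ℚ.≤-trans (mulBound 0≤s+δ (ℚ.≤-trans 0≤s+δ (ℚ.<⇒≤ s+δ<r))
                        (ℚ.<⇒≤ s+δ<r) (ℚ.<⇒≤ s+δ<r))
          (ℚ.≤-trans (√approx-lower (x m) m (ℚ.≤-<-trans 0≤s+δ s+δ<r))
          close))))
      result : ∃[ N ] ∀ m n → N ℕ.≤ m → N ℕ.≤ n → ℚ.∣ r m ℚ.- r n ∣ ℚ.≤ e
      result =
        let N , h = cx (δ ℚ.* δ) 0<δ²
            M , k = archimedean 0<δ
        in N ℕ.⊔ M , λ m n ≤m ≤n →
        let Nm = ℕ.m⊔n≤o⇒m≤o N M ≤m
            Nn = ℕ.m⊔n≤o⇒m≤o N M ≤n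
        in dist-intro (r m) (r n)
          (half m n (dist-elim (x m) (x n) (h m n Nm Nn))
            (k n (ℕ.m⊔n≤o⇒n≤o N M ≤n)))
          (half n m (dist-elim (x n) (x m) (h n m Nn Nm))
            (k m (ℕ.m⊔n≤o⇒n≤o N M ≤m)))

  opaque
    Σ-mono : ∀ k {f g} → (∀ i → i ℕ.< k → f i ℚ.≤ g i) → Σ[ k ] f ℚ.≤ Σ[ k ] g
    Σ-mono zero    h = ℚ.≤-refl
    Σ-mono (suc k) h = ℚ.+-mono-≤
      (Σ-mono k λ i i<k → h i (ℕ.m≤n⇒m≤1+n i<k)) (h k ℕ.≤-refl)

    Σ-cong : ∀ k {f g} → (∀ i → f i ≡ g i) → Σ[ k ] f ≡ Σ[ k ] g
    Σ-cong zero    h = refl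
    Σ-cong (suc k) h = cong₂ ℚ._+_ (Σ-cong k h) (h k)

    Σ-+ : ∀ a b f → Σ[ a ℕ.+ b ] f ≡ Σ[ a ] f ℚ.+ Σ[ b ] λ i → f (a ℕ.+ i)
    Σ-+ a zero f rewrite ℕ.+-identityʳ a = sym (ℚ.+-identityʳ _)
    Σ-+ a (suc b) f rewrite ℕ.+-suc a b =
      trans (cong (ℚ._+ f (a ℕ.+ b)) (Σ-+ a b f))
        (ℚ.+-assoc (Σ[ a ] f) (Σ[ b ] λ i → f (a ℕ.+ i)) (f (a ℕ.+ b)))

    Σ-blocks : ∀ a M f →
      Σ[ a ℕ.* M ] f ≡ Σ[ a ] λ j → Σ[ M ] λ r → f (j ℕ.* M ℕ.+ r)
    Σ-blocks zero    M f = refl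
    Σ-blocks (suc a) M f =
      trans (cong (λ z → Σ[ z ] f) (ℕ.+-comm M (a ℕ.* M)))
      (trans (Σ-+ (a ℕ.* M) M f) (cong (ℚ._+ Σ[ M ] λ i → f (a ℕ.* M ℕ.+ i))
        (Σ-blocks a M f)))

    Σ-const : ∀ M b → Σ[ M ] (λ _ → frac 1 b) ≡ frac M b
    Σ-const zero b = ℚ.≤-antisym (frac-nonNeg 0 b) (frac-≤ 0 b 0 0 ℕ.z≤n)
    Σ-const (suc M) b = trans (cong (ℚ._+ frac 1 b) (Σ-const M b))
      (trans (frac-+ M 1 b) (cong (λ z → frac z b) (ℕ.+-comm M 1)))

    Σ-shift : ∀ k f → f 0 ℚ.+ Σ[ k ] (λ i → f (suc i)) ≡ Σ[ k ] f ℚ.+ f k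
    Σ-shift zero    f = ℚ.+-comm (f 0) 0ℚ
    Σ-shift (suc k) f =
      trans (sym (ℚ.+-assoc (f 0) _ (f (suc k))))
            (cong (ℚ._+ f (suc k)) (Σ-shift k f))

  module _ (q : ℕ) where

    common : ℕ → ℕ → ℕ
    common n m = m ℕ.+ n ℕ.* suc m

    term : ℕ → ℕ → ℚ
    term n i = frac 1 (n ℕ.+ i)

    opaque
      refined : ∀ n m → lnApprox q (common n m) ≡
        Σ[ (q ℕ.∸ 1) ℕ.* suc n ] λ j →
        Σ[ suc m ] λ r → term (common n m) (j ℕ.* suc m ℕ.+ r)
      refined n m = trans
        (cong (λ z → Σ[ z ] (term (common n m)))
          (sym (ℕ.*-assoc (q ℕ.∸ 1) (suc n) (suc m))))
        (Σ-blocks ((q ℕ.∸ 1) ℕ.* suc n) (suc m) (term (common n m)))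

      index : ∀ n m j r → suc (common n m ℕ.+ (j ℕ.* suc m ℕ.+ r))
                        ≡ suc (n ℕ.+ j) ℕ.* suc m ℕ.+ r
      index n m j r = trans (sym (ℕ.+-assoc (suc n ℕ.* suc m) (j ℕ.* suc m) r))
        (cong (ℕ._+ r) (sym (ℕ.*-distribʳ-+ (suc m) (suc n) j)))

      block-upper : ∀ n m j →
        Σ[ suc m ] (λ r → term (common n m) (j ℕ.* suc m ℕ.+ r)) ℚ.≤ term n j
      block-upper n m j = ℚ.≤-trans
        (Σ-mono (suc m) λ r _ → frac-≤ 1 _ 1 b
          (ℕ.*-monoʳ-≤ 1 (subst (suc b ℕ.≤_) (sym (index n m j r))
            (ℕ.m≤m+n (suc b) r))))
        (subst (ℚ._≤ term n j) (sym (Σ-const (suc m) b))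
          (frac-≤ (suc m) b 1 (n ℕ.+ j)
            (ℕ.≤-reflexive (trans (ℕ.*-comm (suc m) (suc (n ℕ.+ j)))
                                  (sym (ℕ.*-identityˡ (suc b)))))))
        where
        b : ℕ
        b = m ℕ.+ (n ℕ.+ j) ℕ.* suc m

      block-lower : ∀ n m j → term n (suc j) ℚ.≤
        Σ[ suc m ] (λ r → term (common n m) (j ℕ.* suc m ℕ.+ r))
      block-lower n m j = ℚ.≤-trans
        (subst (term n (suc j) ℚ.≤_) (sym (Σ-const (suc m) b))
          (frac-≤ 1 (n ℕ.+ suc j) (suc m) b
            (ℕ.≤-reflexive (trans (ℕ.*-identityˡ (suc b))
                                  (ℕ.*-comm (suc (n ℕ.+ suc j)) (suc m))))))
        (Σ-mono (suc m) λ r r<M → frac-≤ 1 b 1 _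
          (ℕ.*-monoʳ-≤ 1 (subst₂ ℕ._≤_ (sym (index n m j r))
            (trans (ℕ.+-comm (suc (n ℕ.+ j) ℕ.* suc m) (suc m))
              (cong (λ z → suc z ℕ.* suc m) (sym (ℕ.+-suc n j))))
            (ℕ.+-monoʳ-≤ (suc (n ℕ.+ j) ℕ.* suc m) (ℕ.<⇒≤ r<M)))))
        where
        b : ℕ
        b = m ℕ.+ (n ℕ.+ suc j) ℕ.* suc m

      refine-upper : ∀ n m → lnApprox q (common n m) ℚ.≤ lnApprox q n
      refine-upper n m = subst (ℚ._≤ lnApprox q n) (sym (refined n m))
        (Σ-mono ((q ℕ.∸ 1) ℕ.* suc n) λ j _ → block-upper n m j)

      refine-lower : ∀ n m →
        lnApprox q n ℚ.≤ lnApprox q (common n m) ℚ.+ frac 1 n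
      refine-lower n m = ℚ.≤-trans
        (subst₂ ℚ._≤_ (ℚ.+-identityʳ _)
          (trans (sym (Σ-shift K (term n)))
            (trans (ℚ.+-comm (term n 0) _)
              (cong (λ z → Σ[ K ] (λ j → term n (suc j)) ℚ.+ frac 1 z)
                (ℕ.+-identityʳ n))))
          (ℚ.+-monoʳ-≤ (lnApprox q n) (frac-nonNeg 1 (n ℕ.+ K))))
        (ℚ.+-monoˡ-≤ (frac 1 n)
          (subst (Σ[ K ] (λ j → term n (suc j)) ℚ.≤_) (sym (refined n m))
            (Σ-mono K λ j _ → block-lower n m j)))
        where
        K : ℕ
        K = (q ℕ.∸ 1) ℕ.* suc n

      common-comm : ∀ n m → common n m ≡ common m n
      common-comm n m = ℕ.suc-injective (ℕ.*-comm (suc n) (suc m))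

    opaque
      ln-cauchy : IsCauchy (lnApprox q)
      ln-cauchy e 0<e = let N , h = archimedean 0<e in N , λ m n N≤m N≤n →
        dist-intro _ _ (half m n (h m N≤m)) (half n m (h n N≤n))
        where
        half : ∀ m n → frac 1 m ℚ.≤ e → lnApprox q m ℚ.≤ lnApprox q n ℚ.+ e
        half m n le = ℚ.≤-trans (refine-lower m n) (ℚ.+-mono-≤
          (subst (λ z → lnApprox q z ℚ.≤ lnApprox q n) (common-comm n m)
            (refine-upper n m))
          le)

open CauchyProofs

infixl 6 _+ℝ_ _-ℝ_
infixl 7 _*ℝ_

fromℕ : ℕ → ℝ
fromℕ k = mkℝ (λ _ → + k / 1) (const-cauchy (+ k / 1))

_+ℝ_ : ℝ → ℝ → ℝ
x +ℝ y = mkℝ (λ n → seq x n ℚ.+ seq y n)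
  (+-cauchy (seq x) (seq y) (cauchy x) (cauchy y))

-ℝ_ : ℝ → ℝ
-ℝ x = mkℝ (λ n → ℚ.- seq x n) (neg-cauchy (seq x) (cauchy x))

_-ℝ_ : ℝ → ℝ → ℝ
x -ℝ y = x +ℝ (-ℝ y)

_*ℝ_ : ℝ → ℝ → ℝ
x *ℝ y = mkℝ (λ n → seq x n ℚ.* seq y n)
  (*-cauchy (seq x) (seq y) (cauchy x) (cauchy y))

∣_∣ℝ : ℝ → ℝ
∣ x ∣ℝ = mkℝ (λ n → ℚ.∣ seq x n ∣) (abs-cauchy (seq x) (cauchy x))

-- √ x is the square root of max(x, 0).
√ : ℝ → ℝ
√ x = mkℝ (λ n → √approx (seq x n) n) (√-cauchy (seq x) (cauchy x))

-- ln q = ∫₁^q dt/t for q ≥ 1; ln 0 = 0 by convention.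
ln : ℕ → ℝ
ln q = mkℝ (lnApprox q) (ln-cauchy q)

infix 4 _⟶_

_⟶_ : (ℕ → ℝ) → ℝ → Set
f ⟶ L = ∀ δ → fromℕ 0 <ℝ δ →
  ∃[ N ] ∀ n → N ℕ.≤ n → ∣ f n -ℝ L ∣ℝ <ℝ δ

{-# OPTIONS --safe #-}

-- Grow S greedily.  A point R that lies on no secant of S sees the points of S
-- on |S| distinct lines, so |S|(q - 1) choices of a new point cover R; averaging
-- over all Q = q² + q + 1 points, some choice lowers the number u of uncovered
-- points to some u′ with (u - u′)/u ≥ |S|(q - 1)/Q.  Since
-- ln u - ln u′ ≥ (u - u′)/u, summing over |S| = 1, …, v gives
--   v(v + 1)/2 · (q - 1)/Q ≤ ln Q - ln u.
-- As long as u > √q the right-hand side is at most (3/2) ln q + 1, so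
-- v ≤ √(3 q ln q) + O(√q).  Once u ≤ √q, adding all uncovered points to S
-- costs only √q more, and O(√q) is absorbed by ε(q) √(q ln q) with ε(q) of
-- order 1/√(log₂ q).
--
-- The inequalities on ln hold for each Riemann sum with a fixed mesh separately.

module Submission where

open import Data.Bool.Base using (true; false)
open import Data.Fin.Base using (Fin; zero; suc)
import Data.Fin.Properties as Fin
open import Data.Fin.Subset using (Subset; ∣_∣; _∈_; _∉_; _∪_; ⁅_⁆; _⊆_)
open import Data.Fin.Subset.Properties
  using (_∈?_; x∈p∪q⁻; p⊆p∪q; q⊆p∪q; x∈⁅x⁆; x∈⁅y⁆⇒x≡y; ∣⁅x⁆∣≡1
        ; p⊂q⇒∣p∣<∣q∣; ∣p∣≤n; anySubset?)
open import Data.Nat.Base as ℕ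
  using (ℕ; zero; suc; _+_; _*_; _∸_; _^_; _≤_; _<_; z≤n; s≤s; ⌊_/2⌋; ⌈_/2⌉)
open import Data.Nat.Induction using (<-rec; <-wellFounded)
open import Data.Nat.Logarithm
  using (⌊log₂_⌋; ⌊log₂⌋-mono-≤; ⌊log₂[2^n]⌋≡n; ⌊log₂⌊n/2⌋⌋≡⌊log₂n⌋∸1)
import Data.Nat.Properties as ℕ
open import Algebra.Properties.CommutativeMonoid.Sum ℕ.+-0-commutativeMonoid
  using (sum; sum-cong-≗; ∑-distrib-+; ∑-comm)
open import Algebra.Properties.Semiring.Sum ℕ.+-*-semiring
  using (*-distribˡ-sum; *-distribʳ-sum)
open import Data.Nat.Tactic.RingSolver using (solve-∀)
open import Data.Product using (∃-syntax; _×_; _,_; proj₁; proj₂)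
open import Data.Rational.Base as ℚ using (ℚ; 0ℚ; 1ℚ; ½)
import Data.Rational.Properties as ℚ
open import Data.Rational.Solver using (module +-*-Solver)
open import Data.Sum.Base using (inj₁; inj₂)
open import Data.Unit.Base using (tt)
open import Data.Vec.Base using ([]; _∷_; tabulate)
open import Data.Vec.Properties using (lookup⇒[]=; lookup∘tabulate)
open import Function.Base using (_∘_; id)
open import Induction.WellFounded using (Acc; acc)
open import Relation.Binary.PropositionalEquality
  using (_≡_; _≢_; refl; sym; trans; cong; subst; subst₂)
open import Relation.Nullary
  using (¬_; Dec; yes; no; does; contradiction; ¬?; _×-dec_; _→-dec_
        ; decidable-stable)
open import Relation.Unary using (Decidable)
open import Defs
open CauchyProofs
open +-*-Solver using (solve; con; _:=_; _:+_; _:*_; _:-_)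

-- Counting in finite sets

⟦_⟧ : ∀ {A : Set} → Dec A → ℕ
⟦ yes _ ⟧ = 1
⟦ no  _ ⟧ = 0

⟦⟧-mono : ∀ {A B : Set} (a : Dec A) (b : Dec B) → (A → B) → ⟦ a ⟧ ≤ ⟦ b ⟧
⟦⟧-mono (no _)  _       _ = z≤n
⟦⟧-mono (yes _) (yes _) _ = ℕ.≤-refl
⟦⟧-mono (yes a) (no ¬b) f = contradiction (f a) ¬b

⟦⟧-lower : ∀ {A : Set} (a : Dec A) {n} → (A → 1 ≤ n) → ⟦ a ⟧ ≤ n
⟦⟧-lower (no _)  _ = z≤n
⟦⟧-lower (yes a) f = f a

⟦⟧-yes : ∀ {A : Set} (a : Dec A) → A → 1 ≤ ⟦ a ⟧
⟦⟧-yes (yes _) _ = ℕ.≤-refl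
⟦⟧-yes (no ¬a) a = contradiction a ¬a

sum-mono : ∀ {n} {f g : Fin n → ℕ} → (∀ i → f i ≤ g i) → sum f ≤ sum g
sum-mono {zero}  h = z≤n
sum-mono {suc n} h = ℕ.+-mono-≤ (h zero) (sum-mono (h ∘ suc))

-- Turns disjointness into a count: a new point that serves at most one `A` in `S` contributes at
-- most once to a double sum.
sum-⟦⟧-unique : ∀ {n} {A : Fin n → Set} {B : Set}
  (a : ∀ i → Dec (A i)) (b : Dec B) →
  (∀ i j → A i → A j → i ≡ j) → (∀ i → A i → B) → sum (λ i → ⟦ a i ⟧) ≤ ⟦ b ⟧
sum-⟦⟧-unique {zero}  a b unique h = z≤n
sum-⟦⟧-unique {suc n} a b unique h with a zero
... | no  _  = sum-⟦⟧-unique (a ∘ suc) b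
  (λ i j Ai Aj → Fin.suc-injective (unique (suc i) (suc j) Ai Aj)) (h ∘ suc)
... | yes A₀ = ℕ.≤-trans
  (ℕ.+-mono-≤ (⟦⟧-yes b (h zero A₀))
    -- Index `zero` uses up the only hit, so the tail is compared with the indicator `no id` of the
    -- empty type.
    (sum-⟦⟧-unique (a ∘ suc) (no id)
      (λ i j Ai Aj → Fin.suc-injective (unique (suc i) (suc j) Ai Aj))
      (λ i Ai → contradiction (unique zero (suc i) A₀ Ai) λ ())))
  (ℕ.≤-reflexive (ℕ.+-identityʳ ⟦ b ⟧))

sum≤n*max : ∀ {n} (f : Fin (suc n) → ℕ) → ∃[ i ] sum f ≤ suc n * f i
sum≤n*max {zero}  f = zero , ℕ.≤-refl
sum≤n*max {suc n} f with sum≤n*max (f ∘ suc)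
... | i , h with ℕ.≤-total (f zero) (f (suc i))
...   | inj₁ le = suc i , ℕ.+-mono-≤ le h
...   | inj₂ ge = zero , ℕ.+-monoʳ-≤ (f zero)
                    (ℕ.≤-trans h (ℕ.*-monoʳ-≤ (suc n) ge))

-- The averaging principle; the given index only rules out `n = 0`, where there is nothing to
-- choose.
sum≤n*some : ∀ {n} → Fin n → (f : Fin n → ℕ) → ∃[ i ] sum f ≤ n * f i
sum≤n*some {suc n} _ f = sum≤n*max f

∣tabulate∣ : ∀ {n} {A : Fin n → Set} (a : ∀ i → Dec (A i)) →
  ∣ tabulate (λ i → does (a i)) ∣ ≡ sum (λ i → ⟦ a i ⟧)
∣tabulate∣ {zero}  a = refl
∣tabulate∣ {suc n} a with a zero
... | yes _ = cong suc (∣tabulate∣ (a ∘ suc))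
... | no  _ = ∣tabulate∣ (a ∘ suc)

∈-tabulate⁺ : ∀ {n} {A : Fin n → Set} (a : ∀ i → Dec (A i)) {i} →
  A i → i ∈ tabulate (λ i → does (a i))
∈-tabulate⁺ a {i} Ai = lookup⇒[]= i _ (trans (lookup∘tabulate _ i) (eq (a i)))
  where
  eq : ∀ d → does d ≡ true
  eq (yes _) = refl
  eq (no ¬A) = contradiction Ai ¬A

∣p∣≡sum : ∀ {n} (p : Subset n) → ∣ p ∣ ≡ sum (λ i → ⟦ i ∈? p ⟧)
∣p∣≡sum p = trans (cong ∣_∣ (eq p)) (∣tabulate∣ (_∈? p))
  where
  eq : ∀ {n} (p : Subset n) → p ≡ tabulate (λ i → does (i ∈? p))
  eq []          = refl
  eq (true  ∷ p) = cong (true ∷_) (eq p)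
  eq (false ∷ p) = cong (false ∷_) (eq p)

∣p∪q∣≤∣p∣+∣q∣ : ∀ {n} (p q : Subset n) → ∣ p ∪ q ∣ ≤ ∣ p ∣ + ∣ q ∣
∣p∪q∣≤∣p∣+∣q∣ []          []          = z≤n
∣p∪q∣≤∣p∣+∣q∣ (false ∷ p) (false ∷ q) = ∣p∪q∣≤∣p∣+∣q∣ p q
∣p∪q∣≤∣p∣+∣q∣ (false ∷ p) (true  ∷ q)
  rewrite ℕ.+-suc ∣ p ∣ ∣ q ∣ = s≤s (∣p∪q∣≤∣p∣+∣q∣ p q)
∣p∪q∣≤∣p∣+∣q∣ (true  ∷ p) (false ∷ q) = s≤s (∣p∪q∣≤∣p∣+∣q∣ p q)
∣p∪q∣≤∣p∣+∣q∣ (true  ∷ p) (true  ∷ q) = s≤s (ℕ.≤-trans (∣p∪q∣≤∣p∣+∣q∣ p q)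
  (ℕ.+-monoʳ-≤ ∣ p ∣ (ℕ.n≤1+n ∣ q ∣)))

-- The minimum size has to be found constructively: search upward from 0, with `P n` bounding the
-- search.
least : ∀ {P : ℕ → Set} → Decidable P → ∀ {n} → P n →
  ∃[ m ] P m × m ≤ n × (∀ {k} → P k → m ≤ k)
least {P} P? {zero}  Pn = zero , Pn , z≤n , λ _ → z≤n
least {P} P? {suc n} Pn with P? 0
... | yes P₀ = zero , P₀ , z≤n , λ _ → z≤n
... | no ¬P₀ = let m , Pm , m≤n , min = least {P ∘ suc} (P? ∘ suc) Pn in
  suc m , Pm , s≤s m≤n , extend min
  where
  extend : ∀ {m} → (∀ {k} → P (suc k) → m ≤ k) → ∀ {k} → P k → suc m ≤ k
  extend min {zero}  Pk = contradiction Pk ¬P₀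
  extend min {suc k} Pk = s≤s (min Pk)

-- Greedy choice of points

module Covering (Π : ProjectivePlane) where

  open ProjectivePlane Π

  Covered : Subset #points → Point → Set
  Covered S P = ∃[ A ] ∃[ B ] ∃[ l ] A ∈ S × B ∈ S × A ≢ B × A I l × B I l × P I l

  covered? : ∀ S → Decidable (Covered S)
  covered? S P = Fin.any? λ A → Fin.any? λ B → Fin.any? λ l →
    (A ∈? S) ×-dec (B ∈? S) ×-dec ¬? (A Fin.≟ B) ×-dec
    (A I? l) ×-dec (B I? l) ×-dec (P I? l)

  Covered-mono : ∀ {S T P} → S ⊆ T → Covered S P → Covered T P
  Covered-mono S⊆T (A , B , l , A∈S , B∈S , rest) =
    A , B , l , S⊆T A∈S , S⊆T B∈S , rest

  saturating? : Decidable Saturating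
  saturating? S = Fin.all? λ P → ¬? (P ∈? S) →-dec covered? S P

  minimum : ∀ {S} → Saturating S → ∃[ m ] IsMinSaturatingSize m × m ≤ ∣ S ∣
  minimum {S} sat =
    let m , attained , m≤∣S∣ , min = least
          (λ m → anySubset? λ T → saturating? T ×-dec (∣ T ∣ ℕ.≟ m))
          (S , sat , refl)
    in m , (attained , λ T satT → min (T , satT , refl)) , m≤∣S∣

  Uncovered : Subset #points → Point → Set
  Uncovered S P = P ∉ S × ¬ Covered S P

  uncovered? : ∀ S → Decidable (Uncovered S)
  uncovered? S P = ¬? (P ∈? S) ×-dec ¬? (covered? S P)

  Uncovered-anti : ∀ {S T P} → S ⊆ T → Uncovered T P → Uncovered S P
  Uncovered-anti S⊆T (P∉T , ¬cov) = P∉T ∘ S⊆T , ¬cov ∘ Covered-mono S⊆T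

  uncoveredSet : Subset #points → Subset #points
  uncoveredSet S = tabulate λ P → does (uncovered? S P)

  #uncovered : Subset #points → ℕ
  #uncovered S = sum λ P → ⟦ uncovered? S P ⟧

  #uncovered≤#points : ∀ S → #uncovered S ≤ #points
  #uncovered≤#points S =
    subst (_≤ #points) (∣tabulate∣ (uncovered? S)) (∣p∣≤n (uncoveredSet S))

  saturating-completion : ∀ S → ∃[ T ] Saturating T × ∣ T ∣ ≤ ∣ S ∣ + #uncovered S
  saturating-completion S = S ∪ uncoveredSet S , sat ,
    ℕ.≤-trans (∣p∪q∣≤∣p∣+∣q∣ S (uncoveredSet S))
      (ℕ.≤-reflexive (cong (∣ S ∣ +_) (∣tabulate∣ (uncovered? S))))
    where
    sat : Saturating (S ∪ uncoveredSet S)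
    sat P P∉ = Covered-mono (p⊆p∪q (uncoveredSet S))
      (decidable-stable (covered? S P) λ ¬cov →
        P∉ (q⊆p∪q S _ (∈-tabulate⁺ (uncovered? S) (P∉ ∘ p⊆p∪q _ , ¬cov))))

  module Greedy (p : ℕ) (order : HasOrder Π (suc p)) where

    open HasOrder order

    -- `P` is a third point of the line `AR`; adding it to `S` turns that line into a secant through
    -- `R`.
    Fan : Subset #points → Point → Point → Point → Set
    Fan S R P A = A ∈ S × P ≢ A × P ≢ R × ∃[ l ] A I l × R I l × P I l

    fan? : ∀ S R P → Decidable (Fan S R P)
    fan? S R P A = (A ∈? S) ×-dec ¬? (P Fin.≟ A) ×-dec ¬? (P Fin.≟ R) ×-dec
      Fin.any? λ l → (A I? l) ×-dec (R I? l) ×-dec (P I? l)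

    join-unique : ∀ {A B k l} → A ≢ B → A I k → B I k → A I l → B I l → k ≡ l
    join-unique A≢B Ak Bk Al Bl = let _ , _ , unique = join A≢B in
      trans (sym (unique (Ak , Bk))) (unique (Al , Bl))

    -- Both lines join `P` and `R`, hence coincide; if `A ≢ B`, this line would be a secant of `S`
    -- through `R`.
    fan-unique : ∀ {S R} P → Uncovered S R → ∀ A B →
      Fan S R P A → Fan S R P B → A ≡ B
    fan-unique P (_ , ¬cov) A B (A∈S , _ , P≢R , k , Ak , Rk , Pk)
                                (B∈S , _ , _ , l , Bl , Rl , Pl)
      with A Fin.≟ B
    ... | yes A≡B = A≡B
    ... | no  A≢B with join-unique P≢R Pk Rk Pl Rl
    ...   | refl = contradiction (A , B , k , A∈S , B∈S , A≢B , Ak , Bl , Rk) ¬cov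

    fan-covers : ∀ {S R P A} → Fan S R P A → ¬ Uncovered (S ∪ ⁅ P ⁆) R
    fan-covers {S} {R} {P} {A} (A∈S , P≢A , _ , l , Al , Rl , Pl) (_ , ¬cov) =
      ¬cov (A , P , l , p⊆p∪q _ A∈S , q⊆p∪q S _ (x∈⁅x⁆ P) ,
            P≢A ∘ sym , Al , Pl , Rl)

    -- The line `AR` has `q + 1 = p + 2` points; discarding `A` and `R` leaves `p`.
    fan-size : ∀ {S R A} → Uncovered S R → A ∈ S →
      p ≤ sum (λ P → ⟦ fan? S R P A ⟧)
    fan-size {S} {R} {A} (R∉S , _) A∈S = ℕ.+-cancelʳ-≤ 2 _ _ (begin
      p + 2                                         ≡⟨ ℕ.+-suc p 1 ⟩
      suc p + 1                                     ≡⟨ ∣pointsOn∣ l ⟨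
      ∣ pointsOn l ∣                                ≡⟨ ∣tabulate∣ (_I? l) ⟩
      sum (λ P → ⟦ P I? l ⟧)                        ≤⟨ sum-mono split ⟩
      sum (λ P → ⟦ fan? S R P A ⟧ + (⟦ P Fin.≟ A ⟧ + ⟦ P Fin.≟ R ⟧))
        ≡⟨ ∑-distrib-+ (λ P → ⟦ fan? S R P A ⟧) _ ⟩
      X + sum (λ P → ⟦ P Fin.≟ A ⟧ + ⟦ P Fin.≟ R ⟧)
        ≡⟨ cong (X +_) (∑-distrib-+ (λ P → ⟦ P Fin.≟ A ⟧) _) ⟩
      X + (sum (λ P → ⟦ P Fin.≟ A ⟧) + sum (λ P → ⟦ P Fin.≟ R ⟧))
        ≤⟨ ℕ.+-monoʳ-≤ X (ℕ.+-mono-≤ (single A) (single R)) ⟩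
      X + 2                                         ∎)
      where
      open ℕ.≤-Reasoning
      X : ℕ
      X = sum (λ P → ⟦ fan? S R P A ⟧)
      A≢R : A ≢ R
      A≢R refl = R∉S A∈S
      l : Line
      l = proj₁ (join A≢R)
      Al : A I l
      Al = proj₁ (proj₁ (proj₂ (join A≢R)))
      Rl : R I l
      Rl = proj₂ (proj₁ (proj₂ (join A≢R)))
      single : ∀ B → sum (λ P → ⟦ P Fin.≟ B ⟧) ≤ 1
      single B = sum-⟦⟧-unique (Fin._≟ B) (yes tt)
        (λ _ _ i≡B j≡B → trans i≡B (sym j≡B)) (λ _ _ → tt)
      split : ∀ P →
        ⟦ P I? l ⟧ ≤ ⟦ fan? S R P A ⟧ + (⟦ P Fin.≟ A ⟧ + ⟦ P Fin.≟ R ⟧)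
      split P = ⟦⟧-lower (P I? l) λ Pl → cases Pl (P Fin.≟ A) (P Fin.≟ R)
        where
        cases : P I l → (a : Dec (P ≡ A)) (b : Dec (P ≡ R)) →
          1 ≤ ⟦ fan? S R P A ⟧ + (⟦ a ⟧ + ⟦ b ⟧)
        cases Pl (yes _)  b       =
          ℕ.≤-trans (s≤s z≤n) (ℕ.m≤n+m _ ⟦ fan? S R P A ⟧)
        cases Pl (no _)   (yes _) = ℕ.m≤n+m 1 ⟦ fan? S R P A ⟧
        cases Pl (no P≢A) (no P≢R) = ℕ.≤-trans
          (⟦⟧-yes (fan? S R P A) (A∈S , P≢A , P≢R , l , Al , Rl , Pl))
          (ℕ.m≤m+n _ 0)

    -- Double counting of pairs `(A , P)` in the fan of `R`: each `A` in `S` supplies at least `p`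
    -- of them, while each `P` occurs for at most one `A` and then covers `R`.
    covering-count : ∀ {S R} → Uncovered S R →
      ∣ S ∣ * p ≤ sum (λ P → ⟦ ¬? (uncovered? (S ∪ ⁅ P ⁆) R) ⟧)
    covering-count {S} {R} unc = begin
      ∣ S ∣ * p                            ≡⟨ cong (_* p) (∣p∣≡sum S) ⟩
      sum (λ A → ⟦ A ∈? S ⟧) * p           ≡⟨ *-distribʳ-sum p (λ A → ⟦ A ∈? S ⟧) ⟩
      sum (λ A → ⟦ A ∈? S ⟧ * p)           ≤⟨ sum-mono (λ A → perPoint (A ∈? S)) ⟩
      sum (λ A → sum (λ P → ⟦ fan? S R P A ⟧))
        ≡⟨ ∑-comm (λ A P → ⟦ fan? S R P A ⟧) ⟩
      sum (λ P → sum (λ A → ⟦ fan? S R P A ⟧))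
        ≤⟨ sum-mono (λ P → sum-⟦⟧-unique (fan? S R P)
             (¬? (uncovered? (S ∪ ⁅ P ⁆) R)) (fan-unique P unc)
             (λ A → fan-covers {S} {R} {P} {A})) ⟩
      sum (λ P → ⟦ ¬? (uncovered? (S ∪ ⁅ P ⁆) R) ⟧) ∎
      where
      open ℕ.≤-Reasoning
      perPoint : ∀ {A} (a : Dec (A ∈ S)) →
        ⟦ a ⟧ * p ≤ sum (λ P → ⟦ fan? S R P A ⟧)
      perPoint (yes A∈S) =
        ℕ.≤-trans (ℕ.≤-reflexive (ℕ.*-identityˡ p)) (fan-size unc A∈S)
      perPoint (no _)    = z≤n

    gain : Subset #points → Point → ℕ
    gain S P = sum λ R → ⟦ uncovered? S R ⟧ * ⟦ ¬? (uncovered? (S ∪ ⁅ P ⁆) R) ⟧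

    gain-bound : ∀ S P → gain S P + #uncovered (S ∪ ⁅ P ⁆) ≤ #uncovered S
    gain-bound S P = ℕ.≤-trans
      (ℕ.≤-reflexive (sym (∑-distrib-+ (λ R →
        ⟦ uncovered? S R ⟧ * ⟦ ¬? (uncovered? (S ∪ ⁅ P ⁆) R) ⟧) _)))
      (sum-mono λ R → pointwise (uncovered? S R) (uncovered? (S ∪ ⁅ P ⁆) R))
      where
      pointwise : ∀ {R} (a : Dec (Uncovered S R))
        (b : Dec (Uncovered (S ∪ ⁅ P ⁆) R)) →
        ⟦ a ⟧ * ⟦ ¬? b ⟧ + ⟦ b ⟧ ≤ ⟦ a ⟧
      pointwise (yes _) (yes _) = ℕ.≤-refl
      pointwise (yes _) (no _)  = ℕ.≤-refl
      pointwise (no _)  (no _)  = z≤n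
      pointwise (no ¬u) (yes u) = contradiction (Uncovered-anti (p⊆p∪q _) u) ¬u

    -- Sum `covering-count` over the uncovered `R`, then exchange the sums over `R` and `P`.
    total-gain : ∀ S → #uncovered S * (∣ S ∣ * p) ≤ sum (gain S)
    total-gain S = begin
      #uncovered S * (∣ S ∣ * p)
        ≡⟨ *-distribʳ-sum (∣ S ∣ * p) (λ R → ⟦ uncovered? S R ⟧) ⟩
      sum (λ R → ⟦ uncovered? S R ⟧ * (∣ S ∣ * p))
        ≤⟨ sum-mono (λ R → pointwise R (uncovered? S R)) ⟩
      sum (λ R → ⟦ uncovered? S R ⟧ *
        sum (λ P → ⟦ ¬? (uncovered? (S ∪ ⁅ P ⁆) R) ⟧))
        ≡⟨ sum-cong-≗ (λ R → *-distribˡ-sum ⟦ uncovered? S R ⟧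
             (λ P → ⟦ ¬? (uncovered? (S ∪ ⁅ P ⁆) R) ⟧)) ⟩
      sum (λ R → sum (λ P →
        ⟦ uncovered? S R ⟧ * ⟦ ¬? (uncovered? (S ∪ ⁅ P ⁆) R) ⟧))
        ≡⟨ ∑-comm (λ R P →
             ⟦ uncovered? S R ⟧ * ⟦ ¬? (uncovered? (S ∪ ⁅ P ⁆) R) ⟧) ⟩
      sum (gain S) ∎
      where
      open ℕ.≤-Reasoning
      pointwise : ∀ R (a : Dec (Uncovered S R)) → ⟦ a ⟧ * (∣ S ∣ * p) ≤
        ⟦ a ⟧ * sum (λ P → ⟦ ¬? (uncovered? (S ∪ ⁅ P ⁆) R) ⟧)
      pointwise R (yes unc) = ℕ.*-monoʳ-≤ 1 (covering-count unc)
      pointwise R (no _)    = z≤n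

    greedy-step : ∀ S → 1 ≤ ∣ S ∣ → 1 ≤ #uncovered S → 1 ≤ p → ∃[ T ]
      ∣ T ∣ ≡ suc ∣ S ∣ × #uncovered T < #uncovered S ×
      #uncovered S * (∣ S ∣ * p) + #points * #uncovered T ≤
        #points * #uncovered S
    greedy-step S 1≤∣S∣ 1≤u 1≤p = T , size , fewer , bound
      where
      best : ∃[ P ] sum (gain S) ≤ #points * gain S P
      best = sum≤n*some (proj₁ quadrangle) (gain S)
      P : Point
      P = proj₁ best
      T : Subset #points
      T = S ∪ ⁅ P ⁆
      bound : #uncovered S * (∣ S ∣ * p) + #points * #uncovered T ≤
        #points * #uncovered S
      bound = begin
        #uncovered S * (∣ S ∣ * p) + #points * #uncovered T
          ≤⟨ ℕ.+-monoˡ-≤ _ (ℕ.≤-trans (total-gain S) (proj₂ best)) ⟩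
        #points * gain S P + #points * #uncovered T
          ≡⟨ ℕ.*-distribˡ-+ #points (gain S P) _ ⟨
        #points * (gain S P + #uncovered T)
          ≤⟨ ℕ.*-monoʳ-≤ #points (gain-bound S P) ⟩
        #points * #uncovered S ∎
        where open ℕ.≤-Reasoning
      fewer : #uncovered T < #uncovered S
      -- The first summand of `bound` is a product of positive factors, so dropping it makes the
      -- inequality strict.
      fewer = ℕ.*-cancelˡ-< #points _ _ (ℕ.<-≤-trans
        (ℕ.+-monoˡ-≤ (#points * #uncovered T)
          (ℕ.*-mono-≤ 1≤u (ℕ.*-mono-≤ 1≤∣S∣ 1≤p)))
        bound)
      P∉S : P ∉ S
      -- If `P` lay in `S`, then `T` would be contained in `S` and could not leave fewer points
      -- uncovered.
      P∉S P∈S = ℕ.<⇒≱ fewer (sum-mono λ R →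
        ⟦⟧-mono (uncovered? S R) (uncovered? T R) (Uncovered-anti T⊆S))
        where
        T⊆S : T ⊆ S
        T⊆S x∈T with x∈p∪q⁻ S ⁅ P ⁆ x∈T
        ... | inj₁ x∈S = x∈S
        ... | inj₂ x∈P = subst (_∈ S) (sym (x∈⁅y⁆⇒x≡y P x∈P)) P∈S
      size : ∣ T ∣ ≡ suc ∣ S ∣
      size = ℕ.≤-antisym
        (ℕ.≤-trans (∣p∪q∣≤∣p∣+∣q∣ S ⁅ P ⁆) (ℕ.≤-reflexive
          (trans (cong (∣ S ∣ +_) (∣⁅x⁆∣≡1 P)) (ℕ.+-comm ∣ S ∣ 1))))
        (p⊂q⇒∣p∣<∣q∣ (p⊆p∪q _ , P , q⊆p∪q S _ (x∈⁅x⁆ P) , P∉S))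

-- Logarithms; recall that frac a b is a/(b + 1)

-- On `[a + 1, a + d + 1]` the integrand is at least `1/(a + d + 1)`. Likewise each of the last
-- `d * suc n` terms is at least `1/(B + 1)`, where `B + 1 = (a + d + 1)(n + 1)`.
ln-gap : ∀ a d n → lnApprox (suc a) n ℚ.+ frac d (a + d) ℚ.≤ lnApprox (suc (a + d)) n
ln-gap a d n = subst (lnApprox (suc a) n ℚ.+ frac d (a + d) ℚ.≤_)
  (sym (trans (cong (λ z → Σ[ z ] recip) (ℕ.*-distribʳ-+ (suc n) a d))
              (Σ-+ (a * suc n) (d * suc n) recip)))
  (ℚ.+-monoʳ-≤ (lnApprox (suc a) n) (begin
    frac d (a + d)
      ≤⟨ frac-≤ d (a + d) (d * suc n) B (ℕ.≤-reflexive (eq d (suc (a + d)) (suc n))) ⟩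
    frac (d * suc n) B
      ≡⟨ Σ-const (d * suc n) B ⟨
    Σ[ d * suc n ] (λ _ → frac 1 B)
      ≤⟨ Σ-mono (d * suc n) (λ i i<k → frac-≤ 1 B 1 (n + (a * suc n + i))
           (ℕ.*-monoʳ-≤ 1 (s≤s (ℕ.+-monoʳ-≤ n (ℕ.≤-trans
             (ℕ.+-monoʳ-≤ (a * suc n) (ℕ.<⇒≤ i<k))
             (ℕ.≤-reflexive (sym (ℕ.*-distribʳ-+ (suc n) a d)))))))) ⟩
    Σ[ d * suc n ] (λ i → recip (a * suc n + i)) ∎))
  where
  open ℚ.≤-Reasoning
  B : ℕ
  B = n + (a + d) * suc n
  recip : ℕ → ℚ
  recip i = frac 1 (n + i)
  eq : ∀ d x y → d * (x * y) ≡ d * y * x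
  eq = solve-∀

p≤p+frac : ∀ x a b → x ℚ.≤ x ℚ.+ frac a b
p≤p+frac x a b = subst (ℚ._≤ x ℚ.+ frac a b) (ℚ.+-identityʳ x)
  (ℚ.+-monoʳ-≤ x (frac-nonNeg a b))

ln-mono : ∀ {a b} n → a ≤ b → lnApprox a n ℚ.≤ lnApprox b n
ln-mono {zero}  {zero}  n a≤b = ℚ.≤-refl
-- Truncated subtraction makes the sums for 0 and for 1 both empty.
ln-mono {zero}  {suc b} n a≤b = ln-mono {1} {suc b} n (s≤s z≤n)
ln-mono {suc a} {suc b} n (s≤s a≤b) =
  subst (λ z → lnApprox (suc a) n ℚ.≤ lnApprox (suc z) n) (ℕ.m+[n∸m]≡n a≤b)
    (ℚ.≤-trans (p≤p+frac _ (b ∸ a) (a + (b ∸ a))) (ln-gap a (b ∸ a) n))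

-- Cut the range of integration at `suc a`. The second piece, rescaled, is the sum for `suc b` on a
-- mesh refined by the factor `suc a`, and refining a left sum of a decreasing function lowers it.
ln-* : ∀ a b n →
  lnApprox (suc a * suc b) n ℚ.≤ lnApprox (suc a) n ℚ.+ lnApprox (suc b) n
ln-* a b n = subst (ℚ._≤ lnApprox (suc a) n ℚ.+ lnApprox (suc b) n)
  (sym (trans (cong (λ z → Σ[ z ] recip) (split a b (suc n)))
    (trans (Σ-+ (a * suc n) (b * (suc n * suc a)) recip)
      (cong (lnApprox (suc a) n ℚ.+_) (Σ-cong (b * (suc n * suc a))
        λ i → cong (frac 1) (shift a n i))))))
  (ℚ.+-monoʳ-≤ (lnApprox (suc a) n) (refine-upper (suc b) n a))
  where
  recip : ℕ → ℚ
  recip i = frac 1 (n + i)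
  split : ∀ a b m → (b + a * suc b) * m ≡ a * m + b * (m * suc a)
  split = solve-∀
  shift : ∀ a n i → n + (a * suc n + i) ≡ (a + n * suc a) + i
  shift = solve-∀

ln≤pred : ∀ q n → lnApprox q n ℚ.≤ frac (q ∸ 1) 0
ln≤pred q n = begin
  lnApprox q n                  ≤⟨ Σ-mono K (λ i _ → frac-≤ 1 (n + i) 1 n
                                     (ℕ.*-monoʳ-≤ 1 (s≤s (ℕ.m≤m+n n i)))) ⟩
  Σ[ K ] (λ _ → frac 1 n)       ≡⟨ Σ-const K n ⟩
  frac K n                      ≤⟨ frac-≤ K n (q ∸ 1) 0
                                     (ℕ.≤-reflexive (ℕ.*-identityʳ K)) ⟩
  frac (q ∸ 1) 0                ∎
  where
  open ℚ.≤-Reasoning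
  K : ℕ
  K = (q ∸ 1) * suc n

-- Uses `q² + q + 1 ≤ 2q²` and `ln 2 ≤ 1`.
ln-#points : ∀ {q} n → 2 ≤ q →
  lnApprox (suc (q * q + q)) n ℚ.≤ 1ℚ ℚ.+ (lnApprox q n ℚ.+ lnApprox q n)
ln-#points {suc p} n (s≤s 1≤p) = begin
  lnApprox (suc (q * q + q)) n   ≤⟨ ln-mono n bound ⟩
  lnApprox (2 * (q * q)) n       ≤⟨ ln-* 1 (p + p * q) n ⟩
  lnApprox 2 n ℚ.+ lnApprox (q * q) n
    ≤⟨ ℚ.+-mono-≤ (ln≤pred 2 n) (ln-* p p n) ⟩
  1ℚ ℚ.+ (lnApprox q n ℚ.+ lnApprox q n) ∎
  where
  open ℚ.≤-Reasoning
  q : ℕ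
  q = suc p
  lhs : ∀ p → suc (suc p * suc p + suc p) ≡ (p * p + 3 * p + 2) + 1
  lhs = solve-∀
  rhs : ∀ p → (p * p + 3 * p + 2) + p * suc p ≡ 2 * (suc p * suc p)
  rhs = solve-∀
  bound : suc (q * q + q) ≤ 2 * (q * q)
  bound = ℕ.≤-trans (ℕ.≤-reflexive (lhs p)) (ℕ.≤-trans
    (ℕ.+-monoʳ-≤ (p * p + 3 * p + 2) (ℕ.*-mono-≤ 1≤p (s≤s z≤n)))
    (ℕ.≤-reflexive (rhs p)))

ln-√ : ∀ {q u} n → q ≤ u * u → lnApprox q n ℚ.≤ lnApprox u n ℚ.+ lnApprox u n
ln-√ {u = zero}  n q≤u² = ln-mono n q≤u²
ln-√ {u = suc u} n q≤u² = ℚ.≤-trans (ln-mono n q≤u²) (ln-* u u n)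

-- Halving `q` lowers `log₂` by one. As `q = h + d` with `d ≥ q/2`, `ln-gap` shows that it lowers
-- the sum by at least `d/q ≥ 1/2`.
½log₂≤ln : ∀ q n → frac ⌊log₂ q ⌋ 1 ℚ.≤ lnApprox q n
½log₂≤ln q n = <-rec (λ q → frac ⌊log₂ q ⌋ 1 ℚ.≤ lnApprox q n) step q
  where
  step : ∀ q → (∀ {r} → r < q → frac ⌊log₂ r ⌋ 1 ℚ.≤ lnApprox r n) →
    frac ⌊log₂ q ⌋ 1 ℚ.≤ lnApprox q n
  step 0 _ = frac-≤ 0 1 0 0 z≤n
  step 1 _ = frac-≤ 0 1 0 0 z≤n
  step q@(suc (suc r)) rec = begin
    frac ⌊log₂ q ⌋ 1
      ≤⟨ frac-≤ ⌊log₂ q ⌋ 1 (⌊log₂ h ⌋ + 1) 1 (ℕ.*-monoˡ-≤ 2 log) ⟩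
    frac (⌊log₂ h ⌋ + 1) 1             ≡⟨ frac-+ ⌊log₂ h ⌋ 1 1 ⟨
    frac ⌊log₂ h ⌋ 1 ℚ.+ frac 1 1
      ≤⟨ ℚ.+-mono-≤ (rec (ℕ.⌊n/2⌋<n (suc r))) (frac-≤ 1 1 d (⌊ r /2⌋ + d) half) ⟩
    lnApprox h n ℚ.+ frac d (⌊ r /2⌋ + d)   ≤⟨ ln-gap ⌊ r /2⌋ d n ⟩
    lnApprox (h + d) n
      ≡⟨ cong (λ z → lnApprox z n) (ℕ.⌊n/2⌋+⌈n/2⌉≡n q) ⟩
    lnApprox q n ∎
    where
    open ℚ.≤-Reasoning
    h d : ℕ
    h = ⌊ q /2⌋
    d = ⌈ q /2⌉
    log : ⌊log₂ q ⌋ ≤ ⌊log₂ h ⌋ + 1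
    log = ℕ.≤-trans (ℕ.m≤n+m∸n ⌊log₂ q ⌋ 1) (ℕ.≤-reflexive
      (trans (cong suc (sym (⌊log₂⌊n/2⌋⌋≡⌊log₂n⌋∸1 q))) (ℕ.+-comm 1 _)))
    double : ∀ d → d + d ≡ d * 2
    double = solve-∀
    half : 1 * suc (⌊ r /2⌋ + d) ≤ d * 2
    half = ℕ.≤-trans (ℕ.≤-reflexive (ℕ.*-identityˡ (h + d)))
      (ℕ.≤-trans (ℕ.+-monoˡ-≤ d (ℕ.⌊n/2⌋≤⌈n/2⌉ q)) (ℕ.≤-reflexive (double d)))

isqrt-bound : ∀ {j n} → j * j ≤ n → j ≤ isqrt n
isqrt-bound {j} {n} j²≤n = ℕ.≮⇒≥ λ lt → ℕ.<-irrefl refl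
  (ℕ.<-≤-trans (isqrt-upper n) (ℕ.≤-trans (ℕ.*-mono-≤ lt lt) j²≤n))

-- An integer of the order of `√(ln q)`, so that the error term is an explicit rational.
√log₂ : ℕ → ℕ
√log₂ q = isqrt ⌊log₂ q ⌋

√log₂-bound : ∀ j {q} → 2 ^ (j * j) ≤ q → j ≤ √log₂ q
√log₂-bound j h = isqrt-bound
  (subst (_≤ _) (⌊log₂[2^n]⌋≡n (j * j)) (⌊log₂⌋-mono-≤ h))

-- The `22` is the multiple of `q` spent in `steps-bound`. Since `1 ≤ l`,
-- `(l + 1)² ≤ 4l² ≤ 4 log₂ q`; with `ln q ≥ (log₂ q)/2` it suffices that `14² = 196` exceeds
-- `22 · 8 = 176`.
ln-√log₂ : ∀ {q} n → 2 ≤ q →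
  frac 22 0 ℚ.≤ frac 14 (√log₂ q) ℚ.* frac 14 (√log₂ q) ℚ.* lnApprox q n
ln-√log₂ {q} n 2≤q = begin
  frac 22 0
    ≤⟨ frac-≤ 22 0 (196 * ⌊log₂ q ⌋) _ bound ⟩
  frac (196 * ⌊log₂ q ⌋) (1 + D * 2)
    ≡⟨ frac-* 196 D ⌊log₂ q ⌋ 1 ⟨
  frac 196 D ℚ.* frac ⌊log₂ q ⌋ 1
    ≤⟨ ℚ.*-monoˡ-≤-nonNeg (frac 196 D) {{ℚ.nonNegative (frac-nonNeg 196 D)}}
         (½log₂≤ln q n) ⟩
  frac 196 D ℚ.* lnApprox q n
    ≡⟨ cong (ℚ._* lnApprox q n) (frac-* 14 l 14 l) ⟨
  frac 14 l ℚ.* frac 14 l ℚ.* lnApprox q n ∎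
  where
  open ℚ.≤-Reasoning
  l D : ℕ
  l = √log₂ q
  D = l + l * suc l
  1≤l : 1 ≤ l
  1≤l = √log₂-bound 1 2≤q
  double : ∀ l → 22 * ((l + l) * (l + l) * 2) ≡ 176 * (l * l)
  double = solve-∀
  bound : 22 * (suc l * suc l * 2) ≤ 196 * ⌊log₂ q ⌋ * 1
  bound = ℕ.≤-trans
    (ℕ.*-monoʳ-≤ 22 (ℕ.*-monoˡ-≤ 2
      (ℕ.*-mono-≤ (ℕ.+-monoˡ-≤ l 1≤l) (ℕ.+-monoˡ-≤ l 1≤l))))
    (ℕ.≤-trans (ℕ.≤-reflexive (double l))
    (ℕ.≤-trans (ℕ.*-mono-≤ (ℕ.m≤n+m 176 20) (isqrt-lower ⌊log₂ q ⌋))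
    (ℕ.≤-reflexive (sym (ℕ.*-identityʳ _)))))

-- The potential argument

-- The last hypothesis says `c/(N + 1) ≤ (u - u′)/u`, and `ln-gap` bounds the right side by the drop
-- of the logarithm. Positivity of `u′` matters because the sums for 0 and 1 agree.
ln-decrease : ∀ {c N u u′} n → u′ ≤ u → 1 ≤ u′ →
  u * c + suc N * u′ ≤ suc N * u →
  frac c N ℚ.+ lnApprox u′ n ℚ.≤ lnApprox u n
ln-decrease {c} {N} {suc b} {suc a} n (s≤s a≤b) _ h
  with b ∸ a | ℕ.m+[n∸m]≡n a≤b
... | d | refl = ℚ.≤-trans
  (subst (ℚ._≤ lnApprox (suc a) n ℚ.+ frac d (a + d))
    (ℚ.+-comm (lnApprox (suc a) n) (frac c N))
    (ℚ.+-monoʳ-≤ (lnApprox (suc a) n) (frac-≤ c N d (a + d) le)))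
  (ln-gap a d n)
  where
  lhs : ∀ u c N a → u * c + suc N * suc a ≡ suc N * suc a + c * u
  lhs = solve-∀
  rhs : ∀ N a d → suc N * suc (a + d) ≡ suc N * suc a + d * suc N
  rhs = solve-∀
  le : c * suc (a + d) ≤ d * suc N
  le = ℕ.+-cancelˡ-≤ (suc N * suc a) _ _ (subst₂ _≤_
    (lhs (suc (a + d)) c N a) (rhs N a d) h)

triangular : ℕ → ℕ
triangular zero    = zero
triangular (suc v) = triangular v + suc v

square≤2triangular : ∀ v → v * v ≤ triangular v + triangular v
square≤2triangular zero    = z≤n
square≤2triangular (suc v) = begin
  suc v * suc v                         ≤⟨ ℕ.m≤n+m _ 1 ⟩
  1 + suc v * suc v                     ≡⟨ lhs v ⟩
  v * v + (suc v + suc v)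
    ≤⟨ ℕ.+-monoˡ-≤ (suc v + suc v) (square≤2triangular v) ⟩
  triangular v + triangular v + (suc v + suc v)
    ≡⟨ rhs (triangular v) (suc v) ⟩
  triangular v + suc v + (triangular v + suc v) ∎
  where
  open ℕ.≤-Reasoning
  lhs : ∀ v → 1 + suc v * suc v ≡ v * v + (suc v + suc v)
  lhs = solve-∀
  rhs : ∀ t s → t + t + (s + s) ≡ t + s + (t + s)
  rhs = solve-∀

module _ (Π : ProjectivePlane) (p : ℕ) (order : HasOrder Π (suc p)) (1≤p : 1 ≤ p)
  where

  open ProjectivePlane Π
  open HasOrder order
  open Covering Π
  open Greedy p order

  private
    N : ℕ
    N = suc p * suc p + suc p

    #points≡1+N : #points ≡ suc N
    #points≡1+N = trans #points≡ (ℕ.+-comm N 1)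

  -- `v` counts greedy steps from a one-point set, made at sizes 1, ..., `v`; `suc N` is the number
  -- of points.
  Potential : ℕ → ℕ → Set
  Potential v u = ∀ n →
    frac (triangular v * p) N ℚ.+ lnApprox u n ℚ.≤ lnApprox (suc N) n

  -- In a greedy run `u` is the uncovered count before the last step, when the set has `suc v`
  -- points. The last step adds one point and the completion at most `t`.
  Outcome : ℕ → Set
  Outcome t = ∃[ v ] ∃[ u ] ∃[ S ]
    t < u × Potential v u × Saturating S × ∣ S ∣ ≤ suc (suc v) + t

  Potential-step : ∀ v {u u′} → u′ ≤ u → 1 ≤ u′ →
    u * (suc v * p) + suc N * u′ ≤ suc N * u →
    Potential v u → Potential (suc v) u′
  Potential-step v {u} {u′} u′≤u 1≤u′ bound pot n = begin
    frac ((triangular v + suc v) * p) N ℚ.+ lnApprox u′ n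
      ≡⟨ cong (λ z → frac z N ℚ.+ lnApprox u′ n)
           (ℕ.*-distribʳ-+ p (triangular v) (suc v)) ⟩
    frac (triangular v * p + suc v * p) N ℚ.+ lnApprox u′ n
      ≡⟨ cong (ℚ._+ lnApprox u′ n)
           (frac-+ (triangular v * p) (suc v * p) N) ⟨
    frac (triangular v * p) N ℚ.+ frac (suc v * p) N ℚ.+ lnApprox u′ n
      ≡⟨ ℚ.+-assoc (frac (triangular v * p) N) (frac (suc v * p) N) _ ⟩
    frac (triangular v * p) N ℚ.+ (frac (suc v * p) N ℚ.+ lnApprox u′ n)
      ≤⟨ ℚ.+-monoʳ-≤ (frac (triangular v * p) N)
           (ln-decrease {suc v * p} {N} n u′≤u 1≤u′ bound) ⟩
    frac (triangular v * p) N ℚ.+ lnApprox u n   ≤⟨ pot n ⟩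
    lnApprox (suc N) n ∎
    where open ℚ.≤-Reasoning

  -- The potential is updated only while the count stays above `t`, hence positive, as `ln-decrease`
  -- requires.
  greedy-run : ∀ {t} S v → ∣ S ∣ ≡ suc v → t < #uncovered S →
    Potential v (#uncovered S) → Acc _<_ (#uncovered S) → Outcome t
  greedy-run {t} S v size t<u pot (acc rec) = next
    (greedy-step S (subst (1 ≤_) (sym size) (s≤s z≤n)) (ℕ.≤-trans (s≤s z≤n) t<u) 1≤p)
    where
    next : (∃[ T ] ∣ T ∣ ≡ suc ∣ S ∣ × #uncovered T < #uncovered S ×
      #uncovered S * (∣ S ∣ * p) + #points * #uncovered T ≤
        #points * #uncovered S) → Outcome t
    next (T , sizeT , fewer , bound) = decide (#uncovered T ℕ.≤? t)
      where
      decide : Dec (#uncovered T ≤ t) → Outcome t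
      decide (yes u′≤t) =
        let C , sat , ∣C∣≤ = saturating-completion T in
        v , #uncovered S , C , t<u , pot , sat , ℕ.≤-trans ∣C∣≤
          (ℕ.+-mono-≤ (ℕ.≤-reflexive (trans sizeT (cong suc size))) u′≤t)
      decide (no u′≰t) = greedy-run T (suc v) (trans sizeT (cong suc size)) t<u′
        (Potential-step v (ℕ.<⇒≤ fewer) (ℕ.≤-trans (s≤s z≤n) t<u′)
          (subst₂ (λ w k → #uncovered S * (w * p) + k * #uncovered T ≤
                           k * #uncovered S)
            size #points≡1+N bound)
          pot)
        (rec fewer)
        where
        t<u′ : t < #uncovered T
        t<u′ = ℕ.≰⇒> u′≰t

  Potential-start : ∀ {u} → u ≤ suc N → Potential 0 u
  Potential-start {u} u≤ n = subst (ℚ._≤ lnApprox (suc N) n)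
    (trans (sym (ℚ.+-identityˡ (lnApprox u n)))
      -- The empty sum in `Σ-const 0 N` identifies `0ℚ` with `frac 0 N`.
      (cong (ℚ._+ lnApprox u n) (Σ-const 0 N)))
    (ln-mono n u≤)

  outcome : ∀ {t} → t ≤ N → Outcome t
  outcome {t} t≤N = decide (#uncovered S ℕ.≤? t)
    where
    S : Subset #points
    S = ⁅ proj₁ quadrangle ⁆
    ∣S∣≡1 : ∣ S ∣ ≡ 1
    ∣S∣≡1 = ∣⁅x⁆∣≡1 (proj₁ quadrangle)
    decide : Dec (#uncovered S ≤ t) → Outcome t
    decide (yes u≤t) =
      let C , sat , ∣C∣≤ = saturating-completion S in
      -- No greedy step is made here; `suc N` is a placeholder for `u` exceeding `t`.
      0 , suc N , C , s≤s t≤N , Potential-start ℕ.≤-refl , sat , ℕ.≤-trans ∣C∣≤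
        (ℕ.+-mono-≤ (ℕ.≤-trans (ℕ.≤-reflexive ∣S∣≡1) (s≤s z≤n)) u≤t)
    decide (no u≰t) = greedy-run S 0 ∣S∣≡1 (ℕ.≰⇒> u≰t)
      (Potential-start (subst (#uncovered S ≤_) #points≡1+N (#uncovered≤#points S)))
      (<-wellFounded _)

-- Rational inequalities

p≤q⇒0≤q-p : ∀ {p q} → p ℚ.≤ q → 0ℚ ℚ.≤ q ℚ.- p
p≤q⇒0≤q-p {p} {q} p≤q = subst (ℚ._≤ q ℚ.- p) (ℚ.+-inverseʳ p)
  (ℚ.+-monoˡ-≤ (ℚ.- p) p≤q)

0≤q-p⇒p≤q : ∀ {p q} → 0ℚ ℚ.≤ q ℚ.- p → p ℚ.≤ q
0≤q-p⇒p≤q {p} {q} 0≤q-p = subst₂ ℚ._≤_ (ℚ.+-identityʳ p) (diff q p)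
  (ℚ.+-monoʳ-≤ p 0≤q-p)

0≤p+q : ∀ {p q} → 0ℚ ℚ.≤ p → 0ℚ ℚ.≤ q → 0ℚ ℚ.≤ p ℚ.+ q
0≤p+q = ℚ.+-mono-≤

0≤p*q : ∀ {p q} → 0ℚ ℚ.≤ p → 0ℚ ℚ.≤ q → 0ℚ ℚ.≤ p ℚ.* q
0≤p*q {p} {q} 0≤p 0≤q = subst (ℚ._≤ p ℚ.* q) (ℚ.*-zeroˡ q)
  (ℚ.*-monoʳ-≤-nonNeg q {{ℚ.nonNegative 0≤q}} 0≤p)

square-cancel-≤ : ∀ {p q} → 0ℚ ℚ.≤ q → p ℚ.* p ℚ.≤ q ℚ.* q → p ℚ.≤ q
square-cancel-≤ {p} {q} 0≤q p²≤q² = ℚ.≮⇒≥ λ q<p → ℚ.<-irrefl refl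
  (ℚ.<-≤-trans
    (ℚ.≤-<-trans (ℚ.*-monoˡ-≤-nonNeg q {{ℚ.nonNegative 0≤q}} (ℚ.<⇒≤ q<p))
      (ℚ.*-monoˡ-<-pos p {{ℚ.positive (ℚ.≤-<-trans 0≤q q<p)}} q<p))
    p²≤q²)

ι : ℕ → ℚ
ι k = frac k 0

0≤ι : ∀ k → 0ℚ ℚ.≤ ι k
0≤ι k = frac-nonNeg k 0

ι-mono : ∀ {a b} → a ≤ b → ι a ℚ.≤ ι b
ι-mono {a} {b} a≤b = frac-≤ a 0 b 0 (ℕ.*-monoˡ-≤ 1 a≤b)

-- Here `L`, `R`, `s` approximate `ln q`, `√3`, `√(q ln q)`. Expanding,
-- `V² ≤ 3qL + 2q + 15L + 10 ≤ 3qL + 22q`, since `L ≤ q` and `2 ≤ q`; this is at most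
-- `(3 + a²)qL ≤ (R + a)²s²`. `identity` adds up the slacks.
steps-bound : ∀ {V q L R a s} → 0ℚ ℚ.≤ R → 0ℚ ℚ.≤ a → 0ℚ ℚ.≤ s → 0ℚ ℚ.≤ q →
  V ℚ.* V ℚ.≤ (q ℚ.+ ι 5) ℚ.* (L ℚ.+ L ℚ.+ L ℚ.+ ι 2) →
  L ℚ.≤ q → ι 2 ℚ.≤ q → ι 3 ℚ.≤ R ℚ.* R → q ℚ.* L ℚ.≤ s ℚ.* s →
  ι 22 ℚ.≤ a ℚ.* a ℚ.* L → V ℚ.≤ (R ℚ.+ a) ℚ.* s
steps-bound {V} {q} {L} {R} {a} {s} 0≤R 0≤a 0≤s 0≤q V² L≤q 2≤q 3≤R² qL≤s² 22≤a²L =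
  square-cancel-≤ (0≤p*q (0≤p+q 0≤R 0≤a) 0≤s) (0≤q-p⇒p≤q
    (subst (0ℚ ℚ.≤_) (identity V q L R a s)
      (0≤p+q (0≤p+q (0≤p+q (0≤p+q (0≤p+q (0≤p+q
        (p≤q⇒0≤q-p V²)
        (0≤p*q (p≤q⇒0≤q-p 3≤R²) (0≤p*q 0≤s 0≤s)))
        (0≤p*q (0≤p*q (0≤p*q (0≤ι 2) 0≤R) 0≤a) (0≤p*q 0≤s 0≤s)))
        (0≤p*q (0≤p+q (0≤ι 3) (0≤p*q 0≤a 0≤a)) (p≤q⇒0≤q-p qL≤s²)))
        (0≤p*q 0≤q (p≤q⇒0≤q-p 22≤a²L)))
        (0≤p*q (0≤ι 15) (p≤q⇒0≤q-p L≤q)))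
        (0≤p*q (0≤ι 5) (p≤q⇒0≤q-p 2≤q)))))
  where
  identity : ∀ V q L R a s →
    ((q ℚ.+ ι 5) ℚ.* (L ℚ.+ L ℚ.+ L ℚ.+ ι 2) ℚ.- V ℚ.* V)
      ℚ.+ (R ℚ.* R ℚ.- ι 3) ℚ.* (s ℚ.* s)
      ℚ.+ ι 2 ℚ.* R ℚ.* a ℚ.* (s ℚ.* s)
      ℚ.+ (ι 3 ℚ.+ a ℚ.* a) ℚ.* (s ℚ.* s ℚ.- q ℚ.* L)
      ℚ.+ q ℚ.* (a ℚ.* a ℚ.* L ℚ.- ι 22)
      ℚ.+ ι 15 ℚ.* (q ℚ.- L)
      ℚ.+ ι 5 ℚ.* (q ℚ.- ι 2)
    ≡ ((R ℚ.+ a) ℚ.* s) ℚ.* ((R ℚ.+ a) ℚ.* s) ℚ.- V ℚ.* V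
  identity = solve 6 (λ V q L R a s →
    ((q :+ con (ι 5)) :* (L :+ L :+ L :+ con (ι 2)) :- V :* V)
      :+ (R :* R :- con (ι 3)) :* (s :* s)
      :+ con (ι 2) :* R :* a :* (s :* s)
      :+ (con (ι 3) :+ a :* a) :* (s :* s :- q :* L)
      :+ q :* (a :* a :* L :- con (ι 22))
      :+ con (ι 15) :* (q :- L)
      :+ con (ι 5) :* (q :- con (ι 2))
    := ((R :+ a) :* s) :* ((R :+ a) :* s) :- V :* V) refl

-- `W² ≤ 9q ≤ 22q ≤ a²qL ≤ a²s²`; the term `13q` in `identity` is the difference `22q - 9q`.
rest-bound : ∀ {W q L a s} → 0ℚ ℚ.≤ a → 0ℚ ℚ.≤ s → 0ℚ ℚ.≤ q →
  W ℚ.* W ℚ.≤ ι 9 ℚ.* q → q ℚ.* L ℚ.≤ s ℚ.* s → ι 22 ℚ.≤ a ℚ.* a ℚ.* L →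
  W ℚ.≤ a ℚ.* s
rest-bound {W} {q} {L} {a} {s} 0≤a 0≤s 0≤q W² qL≤s² 22≤a²L =
  square-cancel-≤ (0≤p*q 0≤a 0≤s) (0≤q-p⇒p≤q
    (subst (0ℚ ℚ.≤_) (identity W q L a s)
      (0≤p+q (0≤p+q (0≤p+q
        (p≤q⇒0≤q-p W²)
        (0≤p*q (0≤p*q 0≤a 0≤a) (p≤q⇒0≤q-p qL≤s²)))
        (0≤p*q 0≤q (p≤q⇒0≤q-p 22≤a²L)))
        (0≤p*q (0≤ι 13) 0≤q))))
  where
  identity : ∀ W q L a s →
    (ι 9 ℚ.* q ℚ.- W ℚ.* W) ℚ.+ (a ℚ.* a) ℚ.* (s ℚ.* s ℚ.- q ℚ.* L)
      ℚ.+ q ℚ.* (a ℚ.* a ℚ.* L ℚ.- ι 22) ℚ.+ ι 13 ℚ.* q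
    ≡ (a ℚ.* s) ℚ.* (a ℚ.* s) ℚ.- W ℚ.* W
  identity = solve 5 (λ W q L a s →
    (con (ι 9) :* q :- W :* W) :+ (a :* a) :* (s :* s :- q :* L)
      :+ q :* (a :* a :* L :- con (ι 22)) :+ con (ι 13) :* q
    := (a :* s) :* (a :* s) :- W :* W) refl

ι-+ : ∀ a b → ι (a + b) ≡ ι a ℚ.+ ι b
ι-+ a b = sym (frac-+ a b 0)

ι-* : ∀ a b → ι (a * b) ≡ ι a ℚ.* ι b
ι-* a b = sym (frac-* a 0 b 0)

frac-ι : ∀ a b → frac a b ℚ.* ι (suc b) ≡ ι a
frac-ι a b = ℚ.≤-antisym
  (subst (ℚ._≤ ι a) (sym (frac-* a b (suc b) 0))
    (frac-≤ (a * suc b) (b * 1) a 0 (ℕ.≤-reflexive (eq a b))))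
  (subst (ι a ℚ.≤_) (sym (frac-* a b (suc b) 0))
    (frac-≤ a 0 (a * suc b) (b * 1) (ℕ.≤-reflexive (sym (eq a b)))))
  where
  eq : ∀ a b → a * suc b * 1 ≡ a * suc (b * 1)
  eq = solve-∀

-- Approximate square roots and the error term

√approx-≤ : ∀ {x b} n → 0ℚ ℚ.≤ b → x ℚ.≤ b ℚ.* b → √approx x n ℚ.≤ b
√approx-≤ {x} {b} n 0≤b x≤b² = ℚ.≮⇒≥ λ b<r →
  ℚ.<-irrefl refl (ℚ.<-≤-trans b<r (square-cancel-≤ 0≤b
    (ℚ.≤-trans (√approx-lower x n (ℚ.≤-<-trans 0≤b b<r)) x≤b²)))

√approx+-sq : ∀ x n → x ℚ.≤ (√approx x n ℚ.+ frac 1 n) ℚ.* (√approx x n ℚ.+ frac 1 n)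
√approx+-sq x n = ℚ.<⇒≤ (√approx-upper x n)

small-multiple : ∀ K {e} → 0ℚ ℚ.< e →
  ∃[ N ] ∀ n → N ≤ n → frac 1 n ℚ.* ι (suc K) ℚ.≤ e
small-multiple K {e} 0<e =
  let N , h = archimedean {e ℚ.* frac 1 K} (ℚ.positive⁻¹ (e ℚ.* frac 1 K)
        {{ℚ.pos*pos⇒pos e {{ℚ.positive 0<e}}
            (frac 1 K) {{ℚ.positive (frac-pos 0 K)}}}})
  in N , λ n N≤n → subst (frac 1 n ℚ.* ι (suc K) ℚ.≤_)
    (trans (ℚ.*-assoc e (frac 1 K) (ι (suc K)))
      (trans (cong (e ℚ.*_) (frac-ι 1 K)) (ℚ.*-identityʳ e)))
    (ℚ.*-monoʳ-≤-nonNeg (ι (suc K)) {{ℚ.nonNegative (0≤ι (suc K))}} (h n N≤n))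

-- Twice the 14/(√log₂ q + 1) with which ln-√log₂ absorbs the O(√q) terms.
error : ℕ → ℝ
error q = mkℝ (λ _ → frac 28 (√log₂ q)) (const-cauchy (frac 28 (√log₂ q)))

error⟶0 : error ⟶ fromℕ 0
error⟶0 δ (e , 0<e , M , 0+e≤δ) =
  let K , small = small-multiple 27 (½-pos 0<e)
  -- From this `q` on, `√log₂ q` is at least `K`, so the error is at most `e/2`; the other half of
  -- `e` witnesses strictness.
  in 2 ^ (K * K) , λ q q≥ → ½ ℚ.* e , ½-pos 0<e , M , λ n M≤n →
    let l = √log₂ q in begin
    ℚ.∣ frac 28 l ℚ.- 0ℚ ∣ ℚ.+ ½ ℚ.* e
      ≡⟨ cong (λ z → ℚ.∣ z ∣ ℚ.+ ½ ℚ.* e) (ℚ.+-identityʳ (frac 28 l)) ⟩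
    ℚ.∣ frac 28 l ∣ ℚ.+ ½ ℚ.* e
      ≡⟨ cong (ℚ._+ ½ ℚ.* e) (ℚ.0≤p⇒∣p∣≡p (frac-nonNeg 28 l)) ⟩
    frac 28 l ℚ.+ ½ ℚ.* e
      ≤⟨ ℚ.+-monoˡ-≤ (½ ℚ.* e)
           (frac-≤ 28 l (1 * 28) (l * 1) (ℕ.*-monoʳ-≤ 28
             (ℕ.≤-reflexive (cong suc (ℕ.*-identityʳ l))))) ⟩
    frac (1 * 28) (l * 1) ℚ.+ ½ ℚ.* e
      ≡⟨ cong (ℚ._+ ½ ℚ.* e) (frac-* 1 l 28 0) ⟨
    frac 1 l ℚ.* ι 28 ℚ.+ ½ ℚ.* e
      ≤⟨ ℚ.+-monoˡ-≤ (½ ℚ.* e) (small l (√log₂-bound K q≥)) ⟩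
    ½ ℚ.* e ℚ.+ ½ ℚ.* e                     ≡⟨ halves e ⟩
    e                                       ≡⟨ ℚ.+-identityˡ e ⟨
    0ℚ ℚ.+ e                                ≤⟨ 0+e≤δ n M≤n ⟩
    seq δ n ∎
  where open ℚ.≤-Reasoning

-- The size estimate at a fixed mesh

-- Source of the constant 3: doubling `T ≤ N - x ≤ 1 + 2y - y/2` gives `3y + 2`. In `v²-bound`, `v`
-- stands for `v²/(q + 5)`, `q` for `q + 5`, and `N`, `x`, `y` for the logarithms of the number of
-- points, of `u` and of the order.
potential-bound : ∀ {v T N q x y Z} → T ℚ.+ x ℚ.≤ N → N ℚ.≤ 1ℚ ℚ.+ (y ℚ.+ y) →
  y ℚ.≤ x ℚ.+ x → v ℚ.≤ T ℚ.+ T → 0ℚ ℚ.≤ q → Z ≡ v ℚ.* q →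
  Z ℚ.≤ q ℚ.* (y ℚ.+ y ℚ.+ y ℚ.+ ι 2)
potential-bound {v} {T} {N} {q} {x} {y} T+x≤N N≤ y≤2x v≤2T 0≤q refl =
  0≤q-p⇒p≤q (subst (0ℚ ℚ.≤_) (identity v T N q x y)
    (0≤p*q 0≤q (0≤p+q (0≤p+q (0≤p+q
      (p≤q⇒0≤q-p v≤2T)
      (0≤p*q (0≤ι 2) (p≤q⇒0≤q-p T+x≤N)))
      (0≤p*q (0≤ι 2) (p≤q⇒0≤q-p N≤)))
      (p≤q⇒0≤q-p y≤2x))))
  where
  identity : ∀ v T N q x y →
    q ℚ.* ((T ℚ.+ T ℚ.- v) ℚ.+ ι 2 ℚ.* (N ℚ.- (T ℚ.+ x))
      ℚ.+ ι 2 ℚ.* (1ℚ ℚ.+ (y ℚ.+ y) ℚ.- N) ℚ.+ (x ℚ.+ x ℚ.- y))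
    ≡ q ℚ.* (y ℚ.+ y ℚ.+ y ℚ.+ ι 2) ℚ.- v ℚ.* q
  identity = solve 6 (λ v T N q x y →
    q :* ((T :+ T :- v) :+ con (ι 2) :* (N :- (T :+ x))
      :+ con (ι 2) :* (con 1ℚ :+ (y :+ y) :- N) :+ (x :+ x :- y))
    := q :* (y :+ y :+ y :+ con (ι 2)) :- v :* q) refl

module _ (p v u : ℕ) (1≤p : 1 ≤ p) where

  private
    q N : ℕ
    q = suc p
    N = q * q + q

  -- The `5` comes from `q² + q + 1 = p² + 3p + 3 ≤ p(p + 6) = p(q + 5)`, by `1 ≤ p`.
  v²-bound : q ≤ u * u → ∀ n →
    frac (triangular v * p) N ℚ.+ lnApprox u n ℚ.≤ lnApprox (suc N) n →
    let L = lnApprox q n in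
    ι v ℚ.* ι v ℚ.≤ (ι q ℚ.+ ι 5) ℚ.* (L ℚ.+ L ℚ.+ L ℚ.+ ι 2)
  v²-bound q≤u² n pot = potential-bound
    {T = frac (triangular v * p) N} {x = lnApprox u n} pot (ln-#points n (s≤s 1≤p))
    (ln-√ {u = u} n q≤u²)
    (subst (frac (v * v) (q + 4) ℚ.≤_)
      (sym (frac-+ (triangular v * p) (triangular v * p) N))
      (frac-≤ (v * v) (q + 4) (triangular v * p + triangular v * p) N bound))
    (0≤p+q (0≤ι q) (0≤ι 5))
    (trans (sym (ι-* v v)) (trans (sym (frac-ι (v * v) (q + 4)))
      (cong (frac (v * v) (q + 4) ℚ.*_)
        (trans (cong ι (sym (ℕ.+-suc q 4))) (ι-+ q 5)))))
    where
    lhs : ∀ p → suc (suc p * suc p + suc p) ≡ p * p + 3 * p + 3 * 1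
    lhs = solve-∀
    rhs : ∀ t p → (t + t) * (p * p + 3 * p + 3 * p) ≡ (t * p + t * p) * suc (suc p + 4)
    rhs = solve-∀
    bound : v * v * suc N ≤ (triangular v * p + triangular v * p) * suc (q + 4)
    bound = ℕ.≤-trans (ℕ.*-mono-≤ (square≤2triangular v)
        (ℕ.≤-trans (ℕ.≤-reflexive (lhs p))
          (ℕ.+-monoʳ-≤ (p * p + 3 * p) (ℕ.*-monoʳ-≤ 3 1≤p))))
      (ℕ.≤-reflexive (rhs (triangular v) p))

-- Adding `h = 1/(n + 1)` to each approximate root makes its square an upper bound, as `steps-bound`
-- and `rest-bound` need. Expanding separates the target product from a slack of order `h`.
final-bound : ∀ {q v n} → 2 ≤ q → let L = lnApprox q n in
  ι v ℚ.* ι v ℚ.≤ (ι q ℚ.+ ι 5) ℚ.* (L ℚ.+ L ℚ.+ L ℚ.+ ι 2) →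
  ι (2 + v + isqrt q) ℚ.≤
    (√approx (ι 3) n ℚ.+ frac 28 (√log₂ q)) ℚ.* √approx (ι q ℚ.* L) n
    ℚ.+ frac 1 n ℚ.* ι (suc (31 + q))
final-bound {q} {v} {n} 2≤q v² = begin
  ι (2 + v + t)
    ≡⟨ trans (cong ι (shuffle v t)) (ι-+ v (2 + t)) ⟩
  ι v ℚ.+ ι (2 + t)
    ≤⟨ ℚ.+-mono-≤
         (steps-bound {V = ι v} (0≤p+q 0≤r 0≤h) 0≤a (0≤p+q 0≤s 0≤h) (0≤ι q) v² L≤q (ι-mono 2≤q)
           (√approx+-sq (ι 3) n) (√approx+-sq (ι q ℚ.* L) n) (ln-√log₂ n 2≤q))
         (rest-bound {W = ι (2 + t)} 0≤a (0≤p+q 0≤s 0≤h) (0≤ι q) t-bound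
           (√approx+-sq (ι q ℚ.* L) n) (ln-√log₂ n 2≤q)) ⟩
  (r ℚ.+ h ℚ.+ a) ℚ.* (s ℚ.+ h) ℚ.+ a ℚ.* (s ℚ.+ h)
    ≡⟨ expand r h a s ⟩
  (r ℚ.+ (a ℚ.+ a)) ℚ.* s ℚ.+ h ℚ.* (r ℚ.+ (a ℚ.+ a) ℚ.+ s ℚ.+ h)
    ≡⟨ cong (λ z → (r ℚ.+ z) ℚ.* s ℚ.+ h ℚ.* (r ℚ.+ z ℚ.+ s ℚ.+ h))
         (frac-+ 14 14 l) ⟩
  (r ℚ.+ ε) ℚ.* s ℚ.+ h ℚ.* (r ℚ.+ ε ℚ.+ s ℚ.+ h)
    ≤⟨ ℚ.+-monoʳ-≤ ((r ℚ.+ ε) ℚ.* s)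
         (ℚ.*-monoˡ-≤-nonNeg h {{ℚ.nonNegative 0≤h}} size) ⟩
  (r ℚ.+ ε) ℚ.* s ℚ.+ h ℚ.* ι (suc (31 + q)) ∎
  where
  open ℚ.≤-Reasoning
  t l : ℕ
  t = isqrt q
  l = √log₂ q
  L r s h a ε : ℚ
  L = lnApprox q n
  r = √approx (ι 3) n
  s = √approx (ι q ℚ.* L) n
  h = frac 1 n
  a = frac 14 l
  ε = frac 28 l
  0≤r : 0ℚ ℚ.≤ r
  0≤r = √approx-nonNeg (ι 3) n
  0≤s : 0ℚ ℚ.≤ s
  0≤s = √approx-nonNeg (ι q ℚ.* L) n
  0≤h : 0ℚ ℚ.≤ h
  0≤h = frac-nonNeg 1 n
  0≤a : 0ℚ ℚ.≤ a
  0≤a = frac-nonNeg 14 l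
  L≤q : L ℚ.≤ ι q
  L≤q = ℚ.≤-trans (ln≤pred q n) (ι-mono (ℕ.m∸n≤m q 1))
  shuffle : ∀ v t → 2 + v + t ≡ v + (2 + t)
  shuffle = solve-∀
  triple : ∀ t → (2 * t + t) * (2 * t + t) ≡ 9 * (t * t)
  triple = solve-∀
  1≤t : 1 ≤ t
  1≤t = isqrt-bound (ℕ.≤-trans (s≤s z≤n) 2≤q)
  2+t≤3t : 2 + t ≤ 2 * t + t
  2+t≤3t = ℕ.+-monoˡ-≤ t (ℕ.*-monoʳ-≤ 2 1≤t)
  t-bound : ι (2 + t) ℚ.* ι (2 + t) ℚ.≤ ι 9 ℚ.* ι q
  t-bound = subst₂ ℚ._≤_ (ι-* (2 + t) (2 + t)) (ι-* 9 q) (ι-mono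
    (ℕ.≤-trans (ℕ.*-mono-≤ 2+t≤3t 2+t≤3t)
    (ℕ.≤-trans (ℕ.≤-reflexive (triple t)) (ℕ.*-monoʳ-≤ 9 (isqrt-lower q)))))
  expand : ∀ r h a s →
    (r ℚ.+ h ℚ.+ a) ℚ.* (s ℚ.+ h) ℚ.+ a ℚ.* (s ℚ.+ h) ≡
    (r ℚ.+ (a ℚ.+ a)) ℚ.* s ℚ.+ h ℚ.* (r ℚ.+ (a ℚ.+ a) ℚ.+ s ℚ.+ h)
  expand = solve 4 (λ r h a s →
    (r :+ h :+ a) :* (s :+ h) :+ a :* (s :+ h) :=
    (r :+ (a :+ a)) :* s :+ h :* (r :+ (a :+ a) :+ s :+ h)) refl
  frac≤ι : ∀ a b → frac a b ℚ.≤ ι a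
  frac≤ι a b = frac-≤ a b a 0 (ℕ.*-monoʳ-≤ a (s≤s z≤n))
  size : r ℚ.+ ε ℚ.+ s ℚ.+ h ℚ.≤ ι (suc (31 + q))
  -- The four summands are at most 3, 28, `q` and 1.
  size = ℚ.≤-trans
    (ℚ.+-mono-≤ (ℚ.+-mono-≤ (ℚ.+-mono-≤
      (√approx-≤ n (0≤ι 3) (subst (ι 3 ℚ.≤_) (ι-* 3 3) (ι-mono (ℕ.m≤m+n 3 6))))
      (frac≤ι 28 l))
      (√approx-≤ n (0≤ι q) (ℚ.*-monoˡ-≤-nonNeg (ι q) {{ℚ.nonNegative (0≤ι q)}} L≤q)))
      (frac≤ι 1 n))
    (ℚ.≤-reflexive (trans (cong (ℚ._+ ι 1) (sym (ι-+ 31 q)))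
      (trans (sym (ι-+ (31 + q) 1)) (cong ι (ℕ.+-comm (31 + q) 1)))))

minimum-bound : ∀ q → 2 ≤ q → (Π : ProjectivePlane) → HasOrder Π q →
  ∃[ m ] ProjectivePlane.IsMinSaturatingSize Π m ×
    fromℕ m ≤ℝ (√ (fromℕ 3) +ℝ error q) *ℝ √ (fromℕ q *ℝ ln q)
minimum-bound q@(suc p) 2≤q@(s≤s 1≤p) Π order =
  conclude (outcome Π p order 1≤p t≤N)
  where
  -- Stopping at `⌊√q⌋` keeps the completion within order `√q`, while `t < u` still forces `q ≤ u²`.
  t : ℕ
  t = isqrt q
  t≤N : t ≤ q * q + q
  t≤N = ℕ.≤-trans (square≥ t) (ℕ.≤-trans (isqrt-lower q) (ℕ.m≤n+m q (q * q)))
    where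
    square≥ : ∀ t → t ≤ t * t
    square≥ zero    = z≤n
    square≥ (suc t) = ℕ.m≤m+n (suc t) (t * suc t)
  conclude : Outcome Π p order 1≤p t →
    ∃[ m ] ProjectivePlane.IsMinSaturatingSize Π m ×
      fromℕ m ≤ℝ (√ (fromℕ 3) +ℝ error q) *ℝ √ (fromℕ q *ℝ ln q)
  conclude (v , u , S , t<u , pot , sat , ∣S∣≤) =
    let m , isMin , m≤∣S∣ = Covering.minimum Π sat in
    m , isMin , λ e 0<e →
    let M , small = small-multiple (31 + q) 0<e in
    M , λ n M≤n → ℚ.≤-trans (ι-mono (ℕ.≤-trans m≤∣S∣ ∣S∣≤))
      (ℚ.≤-trans (final-bound {q} {v} {n} 2≤q (v²-bound p v u 1≤p q≤u² n (pot n)))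
        (ℚ.+-monoʳ-≤ (seq ((√ (fromℕ 3) +ℝ error q) *ℝ √ (fromℕ q *ℝ ln q)) n)
          (small n M≤n)))
    where
    q≤u² : q ≤ u * u
    q≤u² = ℕ.≤-trans (ℕ.<⇒≤ (isqrt-upper q)) (ℕ.*-mono-≤ t<u t<u)

theorem1p6 : ∃[ ε ] (ε ⟶ fromℕ 0) ×
    (∀ (q : ℕ) → 2 ≤ q → (Π : ProjectivePlane) → HasOrder Π q →
    ∃[ m ] ProjectivePlane.IsMinSaturatingSize Π m ×
    fromℕ m ≤ℝ (√ (fromℕ 3) +ℝ ε q) *ℝ √ (fromℕ q *ℝ ln q))
theorem1p6 = error , error⟶0 , minimum-bound
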